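{- Let $\succeq\,\in\{\ge,>\}$ be a relation symbol and let $\varphi\in\mathrm{Fml}_B^{\succeq}(\mathcal L_D)$ be a bounded $\succeq$-pure formula. Then: (i) if $\succeq$ is $>$, then $\varphi$ is $\forall$-robust relative to all domains $D$ of $\varphi$; (ii) if $\succeq$ is $\ge$, then $\varphi$ is $\exists$-robust relative to all domains $D$ of $\varphi$.
   Context: DIFFERENTIAL DYNAMIC LOGIC (dL), continuous fragment. Terms are built from real variables, rational constants, $+$, $\cdot$ and function symbols. Formulas are built from comparisons $p\sim q$ ($\sim\in\{=,\neq,\ge,>,\le,<\}$) by $\wedge,\vee,\neg,\to$, quantifiers over $\mathbb R$, and modalities $[x'=f(x)\&Q]P$ and $\langle x'=f(x)\&Q\rangle P$, where $x$ is a vector of variables, $f$ a vector of terms, $Q$ a formula of first-order real arithmetic (omitted $Q$ means true). Let $\Phi_\omega:[0,\tau_{\max})\to$ states be the right-maximal solution of $x'=f(x)$ from state $\omega$. Then $\omega\models[x'=f(x)\&Q]P$ iff $\Phi_\omega(\tau)\models P$ for all $\tau\in[0,\tau_{\max})$ such that $\Phi_\omega(\xi)\models Q$ for all $\xi\in[0,\tau]$; and $\omega\models\langle x'=f(x)\&Q\rangle P$ iff $\Phi_\omega(\tau)\models P$ for some such $\tau$. Valid means true in all states. "Provable in dL" means derivable in the classical first-order sequent calculus (with cut) extended by the following, where $\alpha$ is an ODE, $y$ is fresh: ($\mathbb R$) every sequent valid in first-order real arithmetic; $\langle\alpha\rangle P\leftrightarrow\neg[\alpha]\neg P$; $\langle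 x'=f(x)\rangle p(x)\leftrightarrow\exists t{\ge}0\,p(y(t))$ if $y(\cdot)$ is a (term-expressible) solution of $y'=f(y)$, $y(0)=x$; $\langle x'=f(x)\&Q\rangle\exists y\,P\leftrightarrow\exists y\langle x'=f(x)\&Q\rangle P$; (K) $[\alpha](P\to R)\to([\alpha]P\to[\alpha]R)$; (V) $P\to[\alpha]P$ if no free variable of $P$ is bound by $\alpha$; (G) from $\vdash P$ infer $\Gamma\vdash[\alpha]P$; (dW) from $Q\vdash P$ infer $\Gamma\vdash[x'=f(x)\&Q]P$; (dI) from $\Gamma,Q\vdash p\succeq q$ and $Q\vdash\dot p\ge\dot q$ infer $\Gamma\vdash[x'=f(x)\&Q]\,p\succeq q$ ($\succeq\in\{\ge,>\}$, dot = Lie derivative along $f$); (dC) from $\Gamma\vdash[x'=f(x)\&Q]C$ and $\Gamma\vdash[x'=f(x)\&Q\wedge C]P$ infer $\Gamma\vdash[x'=f(x)\&Q]P$; (DG) $[x'=f(x)\&Q(x)]P(x)\leftrightarrow\exists y[x'=f(x),y'=a(x)y+b(x)\&Q(x)]P(x)$; (DGi) $[x'=f(x)\&Q(x)]P(x)\to\forall y[x'=f(x),y'=g(x,y)\&Q(x)]P(x)$; (DX) $[x'=f(x)\&Q]P\leftrightarrow(Q\to P\wedge[x'=f(x)\&Q]P)$; (Uniq) $\langle x'=f(x)\&Q_1\wedge Q_2\rangle P\leftrightarrow\langle x'=f(x)\&Q_1\rangle P\wedge\langle x'=f(x)\&Q_2\rangle P$; (Cont) $x=y\to(\langle x'=f(x)\&e>0\rangle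 x\neq y\leftrightarrow e>0)$ if $f(x)\ne0$; (Dadj) $\langle x'=f(x)\&Q(x)\rangle x=y\leftrightarrow\langle y'=-f(y)\&Q(y)\rangle y=x$; (RI) $[x'=f(x)]P\leftrightarrow\forall y[x'=f(x)\&P\vee x=y](x=y\to P\wedge\langle x'=f(x)\&P\vee x=y\rangle x\ne y)$; (BDG) $[x'=f(x),y'=g(x,y)\&Q(x)]\|y\|^2\le p(x)\to([x'=f(x)\&Q(x)]P(x)\leftrightarrow[x'=f(x),y'=g(x,y)\&Q(x)]P(x))$; (FI) $e_0=h(e_1)\leftrightarrow\phi_h(e_0,e_1)$ for each differentially-defined function symbol $h$ with defining formula $\phi_h$ as follows. (For this statement, provability only delimits which functions are in the language.) DIFFERENTIALLY-DEFINED FUNCTIONS. Each is a unary symbol $h$ given by $f\in\mathbb Q[x]^{n+1}$, $x=(x_0,\dots,x_n)$, $X\in\mathbb Q^{n+1}$, $T_0\in\mathbb Q$, with defining formula $\phi_h(x_0,t)\equiv\exists x_1\cdots x_n(\langle x'=-f(x),t'=-1\rangle(x=X\wedge t=T_0)\vee\langle x'=f(x),t'=1\rangle(x=X\wedge t=T_0))$, such that global existence, $\exists x_0\,\phi_h(x_0,t)$, is provable in dL. It is interpreted as $h:\mathbb R\to\mathbb R$, the $x_0$-coordinate of the global solution of $x'=f(x)$, $x(T_0)=X$. LANGUAGE. $\mathbb R_D$ is the ordered field $\mathbb R$ expanded by all these functions; $\mathcal L_D$ is its language (rational constants, $+,\cdot,\ge,>$, and these unary symbols). $\mathrm{FOL}_{\mathbb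 R}$ is the set of formulas without function symbols; functions definable in it may be used as abbreviations. Atomic formulas have the form $t\ge0$ or $t>0$. A bounded formula is $Q_1^{[a_1,b_1]}y_1\cdots Q_n^{[a_n,b_n]}y_n\,\psi$ with $Q_i\in\{\exists,\forall\}$, $\psi$ quantifier-free in conjunctive normal form (a positive combination of atomic formulas), $a_i,b_i$ terms without function symbols in the free variables and $y_1,\dots,y_{i-1}$, where $\exists^{[a,b]}y\,\chi:=\exists y(a\le y\wedge y\le b\wedge\chi)$, $\forall^{[a,b]}y\,\chi:=\forall y(a\le y\wedge y\le b\to\chi)$; the $[a_i,b_i]$ are genuine intervals, i.e. $a_i\le b_i$ for all real values of the free variables and all $y_j\in[a_j,b_j]$, $j<i$. $\mathrm{Fml}_B^{\succeq}(\mathcal L_D)$ is the set of bounded formulas in this normal form that are $\succeq$-pure, i.e. all of whose atomic formulas in $\psi$ are of the form $t\succeq0$ for the one fixed relation $\succeq$. $FV(\varphi)$ is the set of free variables. ENCLOSURES. $\mathbb{IQ}$ is the set of intervals $[\underline a,\overline a]$ with $\underline a\le\overline a$ in $\mathbb Q$. A domain of $\varphi$ is a map $D:FV(\varphi)\to\mathbb{IQ}$, identified with the box $\prod_xD_x$. $\mathrm{Term}(\varphi)$ is the set of terms (including subterms) occurring in $\varphi$, $\mathrm{Term}_F(\varphi)$ the subset of terms $f(e)$ with $f$ a function symbol. An enclosure of $\varphi$ is $I:\mathrm{Term}(\varphi)\to\mathbb{IQ}$, $e\mapsto I_e$, with: $I_x$ arbitrary for free variables $x$; $c\in I_c$ for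 rational constants $c$; $I_a\cup I_b\subseteq I_y$ for $y$ bound by $Q^{[a,b]}y$; $I_{t_1}+I_{t_2}\subseteq I_{t_1+t_2}$ and $I_{t_1}\cdot I_{t_2}\subseteq I_{t_1\cdot t_2}$ (interval arithmetic); $f(I_e)+[-1,1]\subseteq I_{f(e)}$. It extends $D$ if $I|_{FV(\varphi)}=D$. APPROXIMATIONS. An approximation $\mathcal F$ of $\varphi$ assigns to each $f(e)\in\mathrm{Term}_F(\varphi)$ an $\mathrm{FOL}_{\mathbb R}$ formula defining a function $\mathcal F_{f(e)}:\mathbb R\to\mathbb R$. $\|\mathcal F\|_I:=\max_{f(e)\in\mathrm{Term}_F(\varphi)}\sup_{s\in I_e}|\mathcal F_{f(e)}(s)-f(s)|$. For $0<\delta<\frac12$, $\mathcal F$ is $(I,\delta)$ admissible if $\|\mathcal F\|_I<\delta$. A sequence of $I$ admissible approximations $(\mathcal F_\delta)_\delta$ is indexed by a sequence of rationals $\delta=\delta_i\in(0,\frac12)$ with $\delta_i\to0$, each $\mathcal F_{\delta_i}$ being $(I,\delta_i)$ admissible. PERTURBATIONS. $\mathcal A^\forall_{\mathcal F}(\varphi,\delta)$ is defined inductively: it is $\varphi$ if $\varphi$ is atomic without function symbols; for atomic $t(f(e),\vec x)\succeq0$ ($e$ without function symbols) it is $\forall^{[\mathcal F_{f(e)}(e)-\delta,\mathcal F_{f(e)}(e)+\delta]}w\ \mathcal A^\forall_{\mathcal F_{w\mapsto f(e)}}(t(w,\vec x)\succeq0,\delta)$, where $w$ is fresh and replaces $f(e)$,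 and $\mathcal F_{w\mapsto f(e)}(\theta(w,\vec x)):=\mathcal F(\theta(f(e),\vec x))$; it commutes with $\wedge,\vee$ and bounded quantifiers. $\mathcal A^\exists_{\mathcal F}(\varphi,\delta)$ is defined identically with $\exists w$ in place of $\forall w$. ROBUSTNESS. $[\![\varphi]\!]_D:=D\cap[\![\varphi]\!]$ is the set of points of $D$ satisfying $\varphi$ (for sentences, the truth value). $\varphi$ is $\forall$-robust relative to $D$ if there exist an enclosure $I$ extending $D$ and a sequence of $I$ admissible approximations $(\mathcal F_\delta)_\delta$ with $[\![\varphi]\!]_D=\bigcup_\delta[\![\mathcal A^\forall_{\mathcal F_\delta}(\varphi,\delta)]\!]_D$; it is $\exists$-robust relative to $D$ if there exist such $I$ and $(\mathcal F_\delta)_\delta$ with $[\![\varphi]\!]_D=\bigcap_\delta[\![\mathcal A^\exists_{\mathcal F_\delta}(\varphi,\delta)]\!]_D$ (for sentences, union/intersection mean disjunction/conjunction of truth values).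
   Formalization: In the calculus dL that delimits the language, axiom (RI) carries the side condition f(x) ≠ 0 (as for Cont): at an equilibrium with P true, (RI) as printed is false and would make every global existence claim provable, including for symbols with no global solution. -}

module Defs where

open import Level using (0ℓ)
open import Algebra.Bundles using (CommutativeRing)
open import Axiom.ExcludedMiddle using (ExcludedMiddle)
open import Data.Empty using (⊥; ⊥-elim)
open import Data.Fin.Base using (Fin; zero; suc; splitAt; _↑ˡ_; _↑ʳ_)
open import Data.Fin.Permutation using (Permutation′; _⟨$⟩ʳ_; _⟨$⟩ˡ_)
open import Data.Fin.Permutation.Components using (transpose)
open import Data.Integer.Base as ℤ using (ℤ)
open import Data.List.Base as List using (List; []; _∷_; concatMap)
open import Data.List.Membership.Propositional using (_∈_)
open import Data.List.Relation.Binary.Subset.Propositional using (_⊆_)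
open import Data.List.Relation.Unary.All using (All)
open import Data.List.Relation.Unary.Any using (Any)
open import Data.Nat.Base as ℕ using (ℕ; zero; suc; s≤s; s≤s⁻¹)
import Data.Nat.Properties as ℕₚ
open import Data.Product.Base using (Σ-syntax; _×_; _,_; proj₁; proj₂)
open import Data.Rational.Base as ℚ using (ℚ; 0ℚ; ½; 1ℚ)
open import Data.Sum.Base using (_⊎_; inj₁; inj₂; [_,_]′)
open import Data.Unit.Base using (⊤)
open import Data.Vec.Base as Vec using (Vec; lookup; tabulate)
open import Data.Vec.Functional as Vector using (Vector)
open import Function.Base using (_∘_; id)
open import Relation.Binary.PropositionalEquality using (_≡_; refl; cong; cong₂)
open import Relation.Binary.Structures using (IsTotalOrder)
open import Relation.Nullary using (¬_; Dec; yes; no)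
open import Relation.Unary using (Pred; _≐_; ⋃; ⋂)
import Algebra.Definitions.RawMonoid as RawMonoidDefinitions
import Relation.Binary.Construct.NonStrictToStrict as NonStrictToStrict

-- The real numbers, up to isomorphism.  The equality is a setoid equality, and
-- the inverse of 0# is unspecified.

record CompleteOrderedField : Set₁ where
  infix 4 _≤_
  infix 8 _⁻¹

  field
    commutativeRing : CommutativeRing 0ℓ 0ℓ

  open CommutativeRing commutativeRing public

  field
    0≉1          : ¬ (0# ≈ 1#)
    _⁻¹          : Carrier → Carrier
    ⁻¹-cong      : ∀ {x y} → x ≈ y → x ⁻¹ ≈ y ⁻¹
    *-inverseʳ   : ∀ x → ¬ (x ≈ 0#) → x * x ⁻¹ ≈ 1#
    _≤_          : Carrier → Carrier → Set
    isTotalOrder : IsTotalOrder _≈_ _≤_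
    +-monoˡ-≤    : ∀ {x y} z → x ≤ y → x + z ≤ y + z
    *-nonneg     : ∀ {x y} → 0# ≤ x → 0# ≤ y → 0# ≤ x * y

  IsLUB : (Carrier → Set) → Carrier → Set
  IsLUB P s = (∀ x → P x → x ≤ s) × (∀ u → (∀ x → P x → x ≤ u) → s ≤ u)

  field
    complete : ∀ (P : Carrier → Set) → Σ[ x ∈ Carrier ] P x →
               Σ[ u ∈ Carrier ] (∀ x → P x → x ≤ u) → Σ[ s ∈ Carrier ] IsLUB P s

------------------------------------------------------------------------
-- Terms, in a scope of n variables (de Bruijn indices), over a set F of unary
-- function symbols.  Term ⊥ n are the terms without function symbols.

infixl 6 _⊕_
infixl 7 _⊗_

data Term (F : Set) (n : ℕ) : Set where
  var     : Fin n → Term F n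
  con     : ℚ → Term F n
  _⊕_ _⊗_ : Term F n → Term F n → Term F n
  app     : F → Term F n → Term F n

sub : ∀ {F m n} → (Fin m → Term F n) → Term F m → Term F n
sub σ (var i)   = σ i
sub σ (con c)   = con c
sub σ (s ⊕ t)   = sub σ s ⊕ sub σ t
sub σ (s ⊗ t)   = sub σ s ⊗ sub σ t
sub σ (app h t) = app h (sub σ t)

ren : ∀ {F m n} → (Fin m → Fin n) → Term F m → Term F n
ren ρ = sub (var ∘ ρ)

embed : ∀ {F n} → Term ⊥ n → Term F n
embed (var i) = var i
embed (con c) = con c
embed (s ⊕ t) = embed s ⊕ embed t
embed (s ⊗ t) = embed s ⊗ embed t

neg : ∀ {F n} → Term F n → Term F n
neg t = con (ℚ.- 1ℚ) ⊗ t

symbolsᵗ : ∀ {F n} → Term F n → List F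
symbolsᵗ (var _)   = []
symbolsᵗ (con _)   = []
symbolsᵗ (s ⊕ t)   = symbolsᵗ s List.++ symbolsᵗ t
symbolsᵗ (s ⊗ t)   = symbolsᵗ s List.++ symbolsᵗ t
symbolsᵗ (app h t) = h ∷ symbolsᵗ t

subterms : ∀ {F n} → Term F n → List (Term F n)
subterms t@(var _)   = t ∷ []
subterms t@(con _)   = t ∷ []
subterms t@(r ⊕ s)   = t ∷ subterms r List.++ subterms s
subterms t@(r ⊗ s)   = t ∷ subterms r List.++ subterms s
subterms t@(app _ s) = t ∷ subterms s

-- Data (f , X , T₀) of a candidate differentially-defined function: the ODE
-- x' = f(x) in x = (x₀ , … , x_dim) with x(T₀) = X.  It belongs to the language
-- only if its global existence is derivable (InLanguage below).

record Symbol : Set where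
  field
    dim   : ℕ
    rhs   : Vec (Term ⊥ (suc dim)) (suc dim)
    start : Vec ℚ (suc dim)
    time  : ℚ

open Symbol

-- The symbol for the i-th coordinate of the same solution: x₀ and xᵢ exchanged.

coordinate : (h : Symbol) → Fin (suc (dim h)) → Symbol
coordinate h i = record
  { dim   = dim h
  ; rhs   = tabulate λ j → ren τ (lookup (rhs h) (τ j))
  ; start = tabulate λ j → lookup (start h) (τ j)
  ; time  = time h
  }
  where τ = transpose zero i

------------------------------------------------------------------------
-- Formulas.  In box e f Q P, standing for [x' = f(x) & Q] P, the vector x of
-- length k is bound in f, Q and P, where it occupies the first k of the k + n
-- variables, and e holds its initial values.  The usual formula, which reads the
-- initial values from variables x of the ambient scope, has those variables as e.

data Mode : Set where
  first-order modal : Mode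

data Comparison : Set where
  eq ne ge gt le lt : Comparison

infix  8 ~_
infixr 7 _⋏_
infixr 6 _⋎_
infixr 5 _⇒_

data Formula (F : Set) : Mode → ℕ → Set where
  cmp         : ∀ {M n} → Comparison → Term F n → Term F n → Formula F M n
  _⋏_ _⋎_ _⇒_ : ∀ {M n} → Formula F M n → Formula F M n → Formula F M n
  ~_          : ∀ {M n} → Formula F M n → Formula F M n
  ALL EX      : ∀ {M n} → Formula F M (suc n) → Formula F M n
  box dia     : ∀ {k n} → Vec (Term F n) k → Vec (Term F (k ℕ.+ n)) k →
                Formula F first-order (k ℕ.+ n) → Formula F modal (k ℕ.+ n) →
                Formula F modal n

FOLℝ : ℕ → Set
FOLℝ = Formula ⊥ first-order

dL : ℕ → Set
dL = Formula Symbol modal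

lift : ∀ {F m n} k → (Fin m → Term F n) → Fin (k ℕ.+ m) → Term F (k ℕ.+ n)
lift {n = n} k σ i = [ (λ j → var (j ↑ˡ n)) , (λ j → ren (k ↑ʳ_) (σ j)) ]′ (splitAt k i)

liftʳ : ∀ {m n} k → (Fin m → Fin n) → Fin (k ℕ.+ m) → Fin (k ℕ.+ n)
liftʳ {n = n} k ρ i = [ _↑ˡ n , (λ j → k ↑ʳ ρ j) ]′ (splitAt k i)

subᶠ : ∀ {F M m n} → (Fin m → Term F n) → Formula F M m → Formula F M n
subᶠ σ (cmp c s t) = cmp c (sub σ s) (sub σ t)
subᶠ σ (P ⋏ R)     = subᶠ σ P ⋏ subᶠ σ R
subᶠ σ (P ⋎ R)     = subᶠ σ P ⋎ subᶠ σ R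
subᶠ σ (P ⇒ R)     = subᶠ σ P ⇒ subᶠ σ R
subᶠ σ (~ P)       = ~ subᶠ σ P
subᶠ σ (ALL P)     = ALL (subᶠ (lift 1 σ) P)
subᶠ σ (EX P)      = EX (subᶠ (lift 1 σ) P)
subᶠ σ (box {k} e f Q P) =
  box (Vec.map (sub σ) e) (Vec.map (sub (lift k σ)) f) (subᶠ (lift k σ) Q) (subᶠ (lift k σ) P)
subᶠ σ (dia {k} e f Q P) =
  dia (Vec.map (sub σ) e) (Vec.map (sub (lift k σ)) f) (subᶠ (lift k σ) Q) (subᶠ (lift k σ) P)

renᶠ : ∀ {F M m n} → (Fin m → Fin n) → Formula F M m → Formula F M n
renᶠ ρ = subᶠ (var ∘ ρ)

inst : ∀ {F n k} → Vec (Term F n) k → Fin (k ℕ.+ n) → Term F n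
inst {k = k} e i = [ lookup e , var ]′ (splitAt k i)

infix 9 _[_]

_[_] : ∀ {F M n k} → Formula F M (k ℕ.+ n) → Vec (Term F n) k → Formula F M n
P [ e ] = subᶠ (inst e) P

mapᶠ : ∀ {F G M n} → (∀ {m} → Term F m → Term G m) →
       Formula F first-order n → Formula G M n
mapᶠ g (cmp c s t) = cmp c (g s) (g t)
mapᶠ g (P ⋏ R)     = mapᶠ g P ⋏ mapᶠ g R
mapᶠ g (P ⋎ R)     = mapᶠ g P ⋎ mapᶠ g R
mapᶠ g (P ⇒ R)     = mapᶠ g P ⇒ mapᶠ g R
mapᶠ g (~ P)       = ~ mapᶠ g P
mapᶠ g (ALL P)     = ALL (mapᶠ g P)
mapᶠ g (EX P)      = EX (mapᶠ g P)

up : ∀ {F M n} → Formula F first-order n → Formula F M n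
up = mapᶠ id

arithmetic : ∀ {n} → FOLℝ n → dL n
arithmetic = mapᶠ embed

symbols : ∀ {F M n} → Formula F M n → List F
symbols (cmp _ s t) = symbolsᵗ s List.++ symbolsᵗ t
symbols (P ⋏ R)     = symbols P List.++ symbols R
symbols (P ⋎ R)     = symbols P List.++ symbols R
symbols (P ⇒ R)     = symbols P List.++ symbols R
symbols (~ P)       = symbols P
symbols (ALL P)     = symbols P
symbols (EX P)      = symbols P
symbols (box e f Q P) =
  concatMap symbolsᵗ (Vec.toList e) List.++ concatMap symbolsᵗ (Vec.toList f)
  List.++ symbols Q List.++ symbols P
symbols (dia e f Q P) =
  concatMap symbolsᵗ (Vec.toList e) List.++ concatMap symbolsᵗ (Vec.toList f)
  List.++ symbols Q List.++ symbols P

-- Evolution domains are formulas of first-order real arithmetic, that is, they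
-- have no function symbols.  Substitution of terms for parameters of a domain can
-- violate this, so it is a condition on formulas rather than part of their type.

ArithmeticDomains : ∀ {F M n} → Formula F M n → Set
ArithmeticDomains (cmp _ _ _)   = ⊤
ArithmeticDomains (P ⋏ R)       = ArithmeticDomains P × ArithmeticDomains R
ArithmeticDomains (P ⋎ R)       = ArithmeticDomains P × ArithmeticDomains R
ArithmeticDomains (P ⇒ R)       = ArithmeticDomains P × ArithmeticDomains R
ArithmeticDomains (~ P)         = ArithmeticDomains P
ArithmeticDomains (ALL P)       = ArithmeticDomains P
ArithmeticDomains (EX P)        = ArithmeticDomains P
ArithmeticDomains (box _ _ Q P) = symbols Q ≡ [] × ArithmeticDomains P
ArithmeticDomains (dia _ _ Q P) = symbols Q ≡ [] × ArithmeticDomains P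

module _ {F : Set} where

  infix 4 _⇔_

  _⇔_ : ∀ {M n} → Formula F M n → Formula F M n → Formula F M n
  P ⇔ R = (P ⇒ R) ⋏ (R ⇒ P)

  verum falsum : ∀ {M n} → Formula F M n
  verum  = cmp eq (con 0ℚ) (con 0ℚ)
  falsum = cmp ne (con 0ℚ) (con 0ℚ)

  equal differ : ∀ {M n k} → Vec (Term F n) k → Vec (Term F n) k → Formula F M n
  equal  Vec.[]       Vec.[]       = verum
  equal  (s Vec.∷ ss) (t Vec.∷ ts) = cmp eq s t ⋏ equal ss ts
  differ Vec.[]       Vec.[]       = falsum
  differ (s Vec.∷ ss) (t Vec.∷ ts) = cmp ne s t ⋎ differ ss ts

  exs alls : ∀ {M n} k → Formula F M (k ℕ.+ n) → Formula F M n
  exs  zero    P = P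
  exs  (suc k) P = exs k (EX P)
  alls zero    P = P
  alls (suc k) P = alls k (ALL P)

  -- The k most recent variables.
  recent : ∀ {n} k → Vec (Term F (k ℕ.+ n)) k
  recent {n} k = tabulate λ i → var (i ↑ˡ n)

  wk : ∀ {n} k → Term F n → Term F (k ℕ.+ n)
  wk k = ren (k ↑ʳ_)

  wkᶠ : ∀ {M n} k → Formula F M n → Formula F M (k ℕ.+ n)
  wkᶠ k = renᶠ (k ↑ʳ_)

-- φ_h(e₀ , e₁).  The two ODEs have the variables (t , x₀ , … , x_dim).

definingFormula : ∀ {n} → Symbol → Term Symbol n → Term Symbol n → dL n
definingFormula {n} h e₀ e₁ = exs d (reach neg (ℚ.- 1ℚ) ⋎ reach id 1ℚ)
  where
  d = dim h

  reach : (∀ {m} → Term Symbol m → Term Symbol m) → ℚ → dL (d ℕ.+ n)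
  reach sign t′ =
    dia (wk d e₁ Vec.∷ wk d e₀ Vec.∷ recent d)
        (con t′ Vec.∷ Vec.map (λ p → sign (ren (λ i → suc i ↑ˡ (d ℕ.+ n)) (embed p))) (rhs h))
        verum
        (equal (recent (suc (suc d))) (Vec.map con (time h Vec.∷ start h)))

globalExistence : Symbol → dL 1
globalExistence h = EX (definingFormula h (var zero) (var (suc zero)))

-- Lie derivative along f, with dh/ds (s) = f₀(h₀(s) , … , h_dim(s)) for h₀ , … , h_dim
-- the coordinate functions of the ODE of h.

lie : ∀ {n k} → Vec (Term Symbol (k ℕ.+ n)) k → Term Symbol (k ℕ.+ n) → Term Symbol (k ℕ.+ n)
lie {k = k} f (var i) = [ lookup f , (λ _ → con 0ℚ) ]′ (splitAt k i)
lie f (con _)         = con 0ℚ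
lie f (s ⊕ t)         = lie f s ⊕ lie f t
lie f (s ⊗ t)         = (lie f s ⊗ t) ⊕ (s ⊗ lie f t)
lie f (app h t)       = sub (λ i → app (coordinate h i) t) (embed (lookup (rhs h) zero)) ⊗ lie f t

data Strictness : Set where
  weak strict : Strictness

comparison : Strictness → Comparison
comparison weak   = ge
comparison strict = gt

------------------------------------------------------------------------
-- Bounded formulas in normal form, in a scope of n free variables.  All terms of
-- the matrix live in the scope of N variables reached below the prefix.

data Quantifier : Set where
  forAll exists : Quantifier

data Clause (n : ℕ) : Set where
  atom : Term Symbol n → Clause n
  _or_ : Clause n → Clause n → Clause n

data CNF (n : ℕ) : Set where
  clause : Clause n → CNF n
  _and_  : CNF n → CNF n → CNF n

data Prefix : ℕ → ℕ → Set where
  done     : ∀ {n} → Prefix n n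
  quantify : ∀ {n N} → Quantifier → (a b : Term ⊥ n) → Prefix (suc n) N → Prefix n N

record Bounded (n : ℕ) : Set where
  field
    {scope} : ℕ
    prefix  : Prefix n scope
    matrix  : CNF scope

open Bounded

inject : ∀ {n N} → Prefix n N → Fin n → Fin N
inject done               i = i
inject (quantify _ _ _ p) i = inject p (suc i)

atomsᶜ : ∀ {n} → Clause n → List (Term Symbol n)
atomsᶜ (atom t) = t ∷ []
atomsᶜ (C or D) = atomsᶜ C List.++ atomsᶜ D

atoms : ∀ {n} → CNF n → List (Term Symbol n)
atoms (clause C) = atomsᶜ C
atoms (A and B)  = atoms A List.++ atoms B

bound : ∀ {F n} → Quantifier → Formula F first-order (suc n) →
        Formula F first-order (suc n) → Formula F first-order n
bound forAll G P = ALL (G ⇒ P)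
bound exists G P = EX (G ⋏ P)

close : ∀ {F n N} → Prefix n N → Formula F first-order N → Formula F first-order n
close done               P = P
close (quantify q a b p) P =
  bound q (cmp le (wk 1 (embed a)) (var zero) ⋏ cmp le (var zero) (wk 1 (embed b))) (close p P)

mapClause : ∀ {F n} → (Term Symbol n → Formula F first-order n) →
            Clause n → Formula F first-order n
mapClause g (atom t) = g t
mapClause g (C or D) = mapClause g C ⋎ mapClause g D

mapCNF : ∀ {F n} → (Term Symbol n → Formula F first-order n) →
         CNF n → Formula F first-order n
mapCNF g (clause C) = mapClause g C
mapCNF g (A and B)  = mapCNF g A ⋏ mapCNF g B

formula : ∀ {n} → Strictness → Bounded n → Formula Symbol first-order n
formula r φ = close (prefix φ) (mapCNF (λ t → cmp (comparison r) t (con 0ℚ)) (matrix φ))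

prefixTerms : ∀ {n N} → Prefix n N → List (Term Symbol N)
prefixTerms done                 = []
prefixTerms p@(quantify _ a b p′) =
  subterms (embed (ren (inject p) a)) List.++ subterms (embed (ren (inject p) b))
  List.++ var (inject p′ zero) ∷ prefixTerms p′

terms : ∀ {n} (φ : Bounded n) → List (Term Symbol (scope φ))
terms φ = prefixTerms (prefix φ) List.++ concatMap subterms (atoms (matrix φ))

record IQ : Set where
  constructor [_,_]
  field
    lower upper    : ℚ
    .{lower≤upper} : lower ℚ.≤ upper

-- An interval for every free variable in scope.  A variable in scope need not occur
-- in the formula; if all of them do, this is a map on FV(φ).

Domain : ℕ → Set
Domain n = Fin n → IQ

-- A term without function symbols, or an application h(e) occurring in the given
-- term with e without function symbols.

innermost : ∀ {n} → Term Symbol n → Term ⊥ n ⊎ (Symbol × Term ⊥ n)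
innermost (var i) = inj₁ (var i)
innermost (con c) = inj₁ (con c)
innermost (s ⊕ t) with innermost s | innermost t
... | inj₂ x | _      = inj₂ x
... | inj₁ _ | inj₂ x = inj₂ x
... | inj₁ p | inj₁ q = inj₁ (p ⊕ q)
innermost (s ⊗ t) with innermost s | innermost t
... | inj₂ x | _      = inj₂ x
... | inj₁ _ | inj₂ x = inj₂ x
... | inj₁ p | inj₁ q = inj₁ (p ⊗ q)
innermost (app h t) with innermost t
... | inj₂ x = inj₂ x
... | inj₁ p = inj₂ (h , p)

innermost-embed : ∀ {n} (t : Term Symbol n) {p} → innermost t ≡ inj₁ p → t ≡ embed p
innermost-embed (var i) refl = refl
innermost-embed (con c) refl = refl
innermost-embed (s ⊕ t) found with innermost s in eqs | innermost t in eqt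
innermost-embed (s ⊕ t) refl | inj₁ p | inj₁ q =
  cong₂ _⊕_ (innermost-embed s eqs) (innermost-embed t eqt)
innermost-embed (s ⊗ t) found with innermost s in eqs | innermost t in eqt
innermost-embed (s ⊗ t) refl | inj₁ p | inj₁ q =
  cong₂ _⊗_ (innermost-embed s eqs) (innermost-embed t eqt)
innermost-embed (app h t) found with innermost t
innermost-embed (app h t) () | inj₁ _
innermost-embed (app h t) () | inj₂ _

applications : ∀ {F n} → Term F n → ℕ
applications (var _)   = 0
applications (con _)   = 0
applications (s ⊕ t)   = applications s ℕ.+ applications t
applications (s ⊗ t)   = applications s ℕ.+ applications t
applications (app _ t) = suc (applications t)

------------------------------------------------------------------------
-- The metatheory is classical: excluded middle is an explicit assumption.

module Classical (em : ExcludedMiddle 0ℓ) (ℝ : CompleteOrderedField) where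

  open CompleteOrderedField ℝ hiding (zero; refl)
  open NonStrictToStrict _≈_ _≤_ using (_<_)
  open RawMonoidDefinitions +-rawMonoid using () renaming (_×_ to _·_)

  fromℤ : ℤ → Carrier
  fromℤ (ℤ.+ n)     = n · 1#
  fromℤ (ℤ.-[1+ n ]) = - (suc n · 1#)

  fromℚ : ℚ → Carrier
  fromℚ q = fromℤ (ℚ.numerator q) * (ℚ.denominatorℕ q · 1#) ⁻¹

  ∣_∣ : Carrier → Carrier
  ∣ x ∣ = [ (λ _ → x) , (λ _ → - x) ]′ (IsTotalOrder.total isTotalOrder 0# x)

  State : ℕ → Set
  State = Vector Carrier

  eval : ∀ {F n} → (F → Carrier → Carrier) → Term F n → State n → Carrier
  eval J (var i)   ω = ω i
  eval J (con c)   ω = fromℚ c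
  eval J (s ⊕ t)   ω = eval J s ω + eval J t ω
  eval J (s ⊗ t)   ω = eval J s ω * eval J t ω
  eval J (app h t) ω = J h (eval J t ω)

  compare : Comparison → Carrier → Carrier → Set
  compare eq x y = x ≈ y
  compare ne x y = ¬ (x ≈ y)
  compare ge x y = y ≤ x
  compare gt x y = y < x
  compare le x y = x ≤ y
  compare lt x y = x < y

  Sat : ∀ {F n} → (F → Carrier → Carrier) → Formula F first-order n → State n → Set
  Sat J (cmp c s t) ω = compare c (eval J s ω) (eval J t ω)
  Sat J (P ⋏ R)     ω = Sat J P ω × Sat J R ω
  Sat J (P ⋎ R)     ω = Sat J P ω ⊎ Sat J R ω
  Sat J (P ⇒ R)     ω = Sat J P ω → Sat J R ω
  Sat J (~ P)       ω = ¬ Sat J P ω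
  Sat J (ALL P)     ω = ∀ x → Sat J P (x Vector.∷ ω)
  Sat J (EX P)      ω = Σ[ x ∈ Carrier ] Sat J P (x Vector.∷ ω)

  polynomial : ∀ {n} → Term ⊥ n → State n → Carrier
  polynomial = eval (λ ())

  SatFOL : ∀ {n} → FOLℝ n → State n → Set
  SatFOL = Sat (λ ())

  HasDerivativeAt : (Carrier → Carrier) → Carrier → Carrier → Set
  HasDerivativeAt x d t =
    ∀ ε → 0# < ε → Σ[ η ∈ Carrier ] (0# < η ×
      (∀ s → ∣ s - t ∣ ≤ η → ∣ (x s - x t) - d * (s - t) ∣ ≤ ε * ∣ s - t ∣))

  IsGlobalSolution : (h : Symbol) → (Carrier → State (suc (dim h))) → Set
  IsGlobalSolution h x =
    (∀ i → x (fromℚ (time h)) i ≈ fromℚ (lookup (start h) i)) ×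
    (∀ t i → HasDerivativeAt (λ s → x s i) (polynomial (lookup (rhs h) i) (x t)) t)

  -- The x₀-coordinate of the (unique) global solution.  The value 0# is a dummy for
  -- symbols without a global solution, which are not in the language.

  interpretation : Symbol → Carrier → Carrier
  interpretation h t with em {Σ[ x ∈ (Carrier → State (suc (dim h))) ] IsGlobalSolution h x}
  ... | yes (x , _) = x t zero
  ... | no _        = 0#

  value : ∀ {n} → Term Symbol n → State n → Carrier
  value = eval interpretation

  -- Y(t) solves y' = f(y), y(0) = e; the variable t is the most recent one.

  Solves : ∀ {n k} → Vec (Term Symbol n) k → Vec (Term Symbol (k ℕ.+ n)) k →
           Vec (Term Symbol (suc n)) k → Set
  Solves {n} {k} e f Y = ∀ (ω : State n) i →
    value (lookup Y i) (0# Vector.∷ ω) ≈ value (lookup e i) ω ×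
    (∀ t → 0# ≤ t →
      HasDerivativeAt (λ s → value (lookup Y i) (s Vector.∷ ω))
        (value (lookup f i) ((λ j → value (lookup Y j) (t Vector.∷ ω)) Vector.++ ω)) t)

  -- The scope of an ODE with m ghosts y put in front of x.

  ghost : ∀ {n} k m → Fin (k ℕ.+ n) → Fin ((m ℕ.+ k) ℕ.+ n)
  ghost {n} k m i = [ (λ j → (m ↑ʳ j) ↑ˡ n) , ((m ℕ.+ k) ↑ʳ_) ]′ (splitAt k i)

  ghosts : ∀ {n} k m → Vec (Term Symbol ((m ℕ.+ k) ℕ.+ n)) m
  ghosts {n} k m = tabulate λ i → var ((i ↑ˡ k) ↑ˡ n)

  -- [x' = f , y' = g & Q(x)] P(x , y) from the initial values e for x and d for y.

  ghostBox : ∀ {n k m} → Vec (Term Symbol n) m → Vec (Term Symbol ((m ℕ.+ k) ℕ.+ n)) m →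
             Vec (Term Symbol n) k → Vec (Term Symbol (k ℕ.+ n)) k →
             Formula Symbol first-order (k ℕ.+ n) → dL ((m ℕ.+ k) ℕ.+ n) → dL n
  ghostBox {k = k} {m} d g e f Q P =
    box (d Vec.++ e) (g Vec.++ Vec.map (ren (ghost k m)) f) (renᶠ (ghost k m) Q) P

  sumOfSquares : ∀ {n m} → Vec (Term Symbol n) m → Term Symbol n
  sumOfSquares Vec.[]       = con 0ℚ
  sumOfSquares (t Vec.∷ ts) = (t ⊗ t) ⊕ sumOfSquares ts

  permuteScope : ∀ {n k} → Permutation′ k → Fin (k ℕ.+ n) → Fin (k ℕ.+ n)
  permuteScope {n} {k} π i = [ (λ j → (π ⟨$⟩ˡ j) ↑ˡ n) , k ↑ʳ_ ]′ (splitAt k i)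

  -- Modalities start from arbitrary terms e, so these are the axioms for variables x
  -- closed under substitution of terms for the initial values.  Freshness of y and
  -- independence of x or y are expressed by weakening.

  data Axiom : ∀ {n} → dL n → Set where

    dual : ∀ {n k e f Q P} → Axiom {n} (dia {k = k} e f Q P ⇔ ~ box e f Q (~ P))

    barcan : ∀ {n k} {e : Vec (Term Symbol n) k} {f Q P} →
      Axiom (dia e f Q (EX P) ⇔
             EX (dia (Vec.map (wk 1) e) (Vec.map (ren (liftʳ k suc)) f) (renᶠ (liftʳ k suc) Q)
                     (renᶠ ((k ↑ʳ zero) Vector.∷ liftʳ k suc) P)))

    K : ∀ {n k e f Q P R} →
      Axiom {n} (box {k = k} e f Q (P ⇒ R) ⇒ box e f Q P ⇒ box e f Q R)

    V : ∀ {n k e f Q P} → Axiom {n} (P ⇒ box {k = k} e f Q (wkᶠ k P))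

    DG : ∀ {n k} {e : Vec (Term Symbol n) k} {f Q P} a b → let ρ = liftʳ {n} k suc in
      Axiom (box e f Q P ⇔
             EX (ghostBox (var zero Vec.∷ Vec.[])
                          ((ren (ghost k 1 ∘ ρ) a ⊗ var zero) ⊕ ren (ghost k 1 ∘ ρ) b Vec.∷ Vec.[])
                          (Vec.map (wk 1) e) (Vec.map (ren ρ) f) (renᶠ ρ Q)
                          (renᶠ (ghost k 1 ∘ ρ) P)))

    DGi : ∀ {n k m} {e : Vec (Term Symbol n) k} {f Q P} g → let ρ = liftʳ {n} k (m ↑ʳ_) in
      Axiom (box e f Q P ⇒
             alls m (ghostBox (recent m) (Vec.map (ren (liftʳ (m ℕ.+ k) (m ↑ʳ_))) g)
                              (Vec.map (wk m) e) (Vec.map (ren ρ) f) (renᶠ ρ Q)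
                              (renᶠ (ghost k m ∘ ρ) P)))

    DX : ∀ {n k} {e : Vec (Term Symbol n) k} {f Q P} →
      Axiom (box e f Q P ⇔ (up Q [ e ] ⇒ P [ e ] ⋏ box e f Q P))

    Uniq : ∀ {n k e f Q₁ Q₂ P} →
      Axiom {n} (dia {k = k} e f (Q₁ ⋏ Q₂) P ⇔ dia e f Q₁ P ⋏ dia e f Q₂ P)

    Cont : ∀ {n k} {e y : Vec (Term Symbol n) k} {f} p →
      Axiom (differ (Vec.map (sub (inst e)) f) (Vec.replicate k (con 0ℚ)) ⇒
             equal e y ⇒
             (dia e f (cmp gt p (con 0ℚ)) (differ (recent k) (Vec.map (wk k) y)) ⇔
              cmp gt (sub (inst e) p) (con 0ℚ)))

    Dadj : ∀ {n k} {x y : Vec (Term Symbol n) k} {f Q} →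
      Axiom (dia x f Q (equal (recent k) (Vec.map (wk k) y)) ⇔
             dia y (Vec.map neg f) Q (equal (recent k) (Vec.map (wk k) x)))

    -- As for Cont, f(x) ≠ 0 is needed: at an equilibrium the right-hand side of the
    -- equivalence is false, even when P is true.
    RI : ∀ {n k} {e : Vec (Term Symbol n) k} {f} {P : Formula Symbol first-order (k ℕ.+ n)} →
      let ρ  = liftʳ {n} k (k ↑ʳ_)
          ρ′ = liftʳ {k ℕ.+ n} k (k ↑ʳ_)
          x  = recent k
          y  = Vec.map (wk k) (recent k)
          Q  = renᶠ ρ P ⋎ equal x y
      in
      Axiom (differ (Vec.map (sub (inst e)) f) (Vec.replicate k (con 0ℚ)) ⇒
             (box e f verum (up P) ⇔
              alls k (box (Vec.map (wk k) e) (Vec.map (ren ρ) f) Q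
                (equal x y ⇒
                 up (renᶠ ρ P) ⋏
                 dia x (Vec.map (ren ρ′ ∘ ren ρ) f) (renᶠ ρ′ Q)
                     (differ (recent k) (Vec.map (ren ρ′) y))))))

    BDG : ∀ {n k m} {e : Vec (Term Symbol n) k} {f Q P} {d : Vec (Term Symbol n) m} {g} p →
      Axiom (ghostBox d g e f Q (cmp le (sumOfSquares (ghosts k m)) (ren (ghost k m) p)) ⇒
             (box e f Q P ⇔ ghostBox d g e f Q (renᶠ (ghost k m) P)))

    FI : ∀ {n} h (e₀ e₁ : Term Symbol n) →
      Axiom (cmp eq e₀ (app h e₁) ⇔ definingFormula h e₀ e₁)

    -- The equations of an ODE are unordered.
    exchange : ∀ {n k} {e : Vec (Term Symbol n) k} {f Q P} (π : Permutation′ k) →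
      Axiom (box e f Q P ⇔
             box (tabulate λ i → lookup e (π ⟨$⟩ʳ i))
                 (tabulate λ i → ren (permuteScope π) (lookup f (π ⟨$⟩ʳ i)))
                 (renᶠ (permuteScope π) Q) (renᶠ (permuteScope π) P))

  infix 3 _⊢_

  mutual

    -- Every sequent of a derivation is a sequent of the language: its evolution
    -- domains are arithmetic and its function symbols are differentially defined.
    -- As the definition is inductive, the symbols used to derive the global
    -- existence of h have themselves been introduced before h.

    data _⊢_ : ∀ {n} → List (dL n) → List (dL n) → Set where
      derive : ∀ {n} {Γ Δ : List (dL n)} →
        All ArithmeticDomains (Γ List.++ Δ) →
        All (λ h → [] ⊢ globalExistence h ∷ []) (concatMap symbols (Γ List.++ Δ)) →
        Step Γ Δ → Γ ⊢ Δ

    data Step : ∀ {n} → List (dL n) → List (dL n) → Set where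

      init : ∀ {n} {P : dL n} → Step (P ∷ []) (P ∷ [])

      cut : ∀ {n Γ Δ} (P : dL n) → Γ ⊢ P ∷ Δ → P ∷ Γ ⊢ Δ → Step Γ Δ

      structural : ∀ {n} {Γ Γ′ Δ Δ′ : List (dL n)} →
        Γ ⊆ Γ′ → Δ ⊆ Δ′ → Γ ⊢ Δ → Step Γ′ Δ′

      ~L : ∀ {n Γ Δ} {P : dL n} → Γ ⊢ P ∷ Δ → Step (~ P ∷ Γ) Δ
      ~R : ∀ {n Γ Δ} {P : dL n} → P ∷ Γ ⊢ Δ → Step Γ (~ P ∷ Δ)
      ⋏L : ∀ {n Γ Δ} {P R : dL n} → P ∷ R ∷ Γ ⊢ Δ → Step (P ⋏ R ∷ Γ) Δ
      ⋏R : ∀ {n Γ Δ} {P R : dL n} → Γ ⊢ P ∷ Δ → Γ ⊢ R ∷ Δ → Step Γ (P ⋏ R ∷ Δ)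
      ⋎L : ∀ {n Γ Δ} {P R : dL n} → P ∷ Γ ⊢ Δ → R ∷ Γ ⊢ Δ → Step (P ⋎ R ∷ Γ) Δ
      ⋎R : ∀ {n Γ Δ} {P R : dL n} → Γ ⊢ P ∷ R ∷ Δ → Step Γ (P ⋎ R ∷ Δ)
      ⇒L : ∀ {n Γ Δ} {P R : dL n} → Γ ⊢ P ∷ Δ → R ∷ Γ ⊢ Δ → Step ((P ⇒ R) ∷ Γ) Δ
      ⇒R : ∀ {n Γ Δ} {P R : dL n} → P ∷ Γ ⊢ R ∷ Δ → Step Γ ((P ⇒ R) ∷ Δ)

      ALL-L : ∀ {n Γ Δ} {P : dL (suc n)} t → P [ t Vec.∷ Vec.[] ] ∷ Γ ⊢ Δ → Step (ALL P ∷ Γ) Δ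
      ALL-R : ∀ {n Γ Δ} {P : dL (suc n)} →
        List.map (wkᶠ 1) Γ ⊢ P ∷ List.map (wkᶠ 1) Δ → Step Γ (ALL P ∷ Δ)
      EX-L  : ∀ {n Γ Δ} {P : dL (suc n)} →
        P ∷ List.map (wkᶠ 1) Γ ⊢ List.map (wkᶠ 1) Δ → Step (EX P ∷ Γ) Δ
      EX-R  : ∀ {n Γ Δ} {P : dL (suc n)} t → Γ ⊢ P [ t Vec.∷ Vec.[] ] ∷ Δ → Step Γ (EX P ∷ Δ)

      leibniz : ∀ {n} {P : dL (suc n)} s t →
        Step (cmp eq s t ∷ P [ s Vec.∷ Vec.[] ] ∷ []) (P [ t Vec.∷ Vec.[] ] ∷ [])

      real : ∀ {n} {Γ Δ : List (FOLℝ n)} →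
        (∀ ω → All (λ P → SatFOL P ω) Γ → Any (λ P → SatFOL P ω) Δ) →
        Step (List.map arithmetic Γ) (List.map arithmetic Δ)

      axiom : ∀ {n} {P : dL n} → Axiom P → Step [] (P ∷ [])

      -- Y need not occur in the conclusion, so its symbols are constrained separately.
      solution : ∀ {n k e f P} Y → Solves {n} {k} e f Y →
        All (λ h → [] ⊢ globalExistence h ∷ []) (concatMap symbolsᵗ (Vec.toList Y)) →
        Step [] ((dia e f verum P ⇔
                  EX (cmp ge (var zero) (con 0ℚ) ⋏
                      subᶠ (λ i → [ lookup Y , (λ j → var (suc j)) ]′ (splitAt k i)) P)) ∷ [])

      G : ∀ {n k Γ} {e : Vec (Term Symbol n) k} {f Q P} →
        [] ⊢ P ∷ [] → Step Γ (box e f Q P ∷ [])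

      dW : ∀ {n k Γ} {e : Vec (Term Symbol n) k} {f Q P} →
        up Q ∷ [] ⊢ P ∷ [] → Step Γ (box e f Q P ∷ [])

      dI : ∀ {n k Γ} {e : Vec (Term Symbol n) k} {f Q} r p q →
        up Q [ e ] ∷ Γ ⊢ cmp (comparison r) p q [ e ] ∷ [] →
        up Q ∷ [] ⊢ cmp ge (lie {n} f p) (lie {n} f q) ∷ [] →
        Step Γ (box e f Q (cmp (comparison r) p q) ∷ [])

      dC : ∀ {n k Γ} {e : Vec (Term Symbol n) k} {f Q P} C →
        Γ ⊢ box e f Q (up C) ∷ [] → Γ ⊢ box e f (Q ⋏ C) P ∷ [] →
        Step Γ (box e f Q P ∷ [])

  -- h is a differentially-defined function symbol.

  InLanguage : Symbol → Set
  InLanguage h = [] ⊢ globalExistence h ∷ []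

  Genuine : ∀ {n N} → Prefix n N → State n → Set
  Genuine done               ω = ⊤
  Genuine (quantify _ a b p) ω =
    polynomial a ω ≤ polynomial b ω ×
    (∀ y → polynomial a ω ≤ y → y ≤ polynomial b ω → Genuine p (y Vector.∷ ω))

  -- The atomic formulas of φ are t ≥ 0 or t > 0 according to r.

  record BoundedPure (r : Strictness) (n : ℕ) : Set where
    field
      bounded  : Bounded n
      genuine  : ∀ ω → Genuine (prefix bounded) ω
      language : All InLanguage (symbols (formula r bounded))

  infix 4 _∈ᴵ_ _⊆ᴵ_

  _∈ᴵ_ : Carrier → IQ → Set
  x ∈ᴵ I = fromℚ (IQ.lower I) ≤ x × x ≤ fromℚ (IQ.upper I)

  _⊆ᴵ_ : IQ → IQ → Set
  I ⊆ᴵ J = ∀ x → x ∈ᴵ I → x ∈ᴵ J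

  Encloses : ∀ {n N} → Prefix n N → (Term Symbol N → IQ) → Set
  Encloses done                   I = ⊤
  Encloses p@(quantify _ a b p′) I =
    I (embed (ren (inject p) a)) ⊆ᴵ I (var (inject p′ zero)) ×
    I (embed (ren (inject p) b)) ⊆ᴵ I (var (inject p′ zero)) ×
    Encloses p′ I

  -- Only the values of I on terms φ matter.

  record IsEnclosure {n} (φ : Bounded n) (I : Term Symbol (scope φ) → IQ) : Set where
    field
      constant    : ∀ c → con c ∈ terms φ → fromℚ c ∈ᴵ I (con c)
      bounds      : Encloses (prefix φ) I
      sum         : ∀ s t → s ⊕ t ∈ terms φ →
                    ∀ x y → x ∈ᴵ I s → y ∈ᴵ I t → x + y ∈ᴵ I (s ⊕ t)
      product     : ∀ s t → s ⊗ t ∈ terms φ →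
                    ∀ x y → x ∈ᴵ I s → y ∈ᴵ I t → x * y ∈ᴵ I (s ⊗ t)
      application : ∀ h e → app h e ∈ terms φ →
                    ∀ x u → x ∈ᴵ I e → - 1# ≤ u → u ≤ 1# → interpretation h x + u ∈ᴵ I (app h e)

  Extends : ∀ {n} (φ : Bounded n) → (Term Symbol (scope φ) → IQ) → Domain n → Set
  Extends φ I D = ∀ i → I (var (inject (prefix φ) i)) ≡ D i

  -- A formula γ(y , x) of FOLℝ that is the graph of a function y = F(x).

  record Definable : Set where
    field
      graph : FOLℝ 2

    Graph : Carrier → Carrier → Set
    Graph y x = SatFOL graph (y Vector.∷ x Vector.∷ Vector.[])

    field
      total  : ∀ x → Σ[ y ∈ Carrier ] Graph y x
      unique : ∀ x y y′ → Graph y x → Graph y′ x → y ≈ y′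

    function : Carrier → Carrier
    function x = proj₁ (total x)

  open Definable

  -- The value at h and e is the one assigned to the term h(e); it only matters if
  -- h(e) is in terms φ.

  Approximation : ∀ {n} → Bounded n → Set
  Approximation φ = Symbol → Term Symbol (scope φ) → Definable

  -- The norm is the least upper bound of these values; 0 is included to make it 0 if
  -- φ has no function symbols.

  Deviation : ∀ {n} (φ : Bounded n) → (Term Symbol (scope φ) → IQ) → Approximation φ →
              Carrier → Set
  Deviation φ I 𝓕 v =
    v ≈ 0# ⊎
    (Σ[ h ∈ Symbol ] Σ[ e ∈ Term Symbol (scope φ) ] Σ[ s ∈ Carrier ]
      (app h e ∈ terms φ × s ∈ᴵ I e × v ≈ ∣ function (𝓕 h e) s - interpretation h s ∣))

  Admissible : ∀ {n} (φ : Bounded n) → (Term Symbol (scope φ) → IQ) → ℚ → Approximation φ → Set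
  Admissible φ I δ 𝓕 = Σ[ v ∈ Carrier ] (IsLUB (Deviation φ I 𝓕) v × v < fromℚ δ)

  -- Replacement of all occurrences of h(e) in a term by a fresh variable.

  abstractApp : ∀ {n} → Symbol → Term ⊥ n → Term Symbol n → Term Symbol (suc n)
  abstractApp h e (var i)   = var (suc i)
  abstractApp h e (con c)   = con c
  abstractApp h e (s ⊕ t)   = abstractApp h e s ⊕ abstractApp h e t
  abstractApp h e (s ⊗ t)   = abstractApp h e s ⊗ abstractApp h e t
  abstractApp h e (app g t) with em {g ≡ h × t ≡ embed e}
  ... | yes _ = var zero
  ... | no _  = app g (abstractApp h e t)

  abstractApp-≤ : ∀ {n} h e (t : Term Symbol n) →
                  applications (abstractApp h e t) ℕ.≤ applications t
  abstractApp-≤ h e (var i)   = ℕ.z≤n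
  abstractApp-≤ h e (con c)   = ℕ.z≤n
  abstractApp-≤ h e (s ⊕ t)   = ℕₚ.+-mono-≤ (abstractApp-≤ h e s) (abstractApp-≤ h e t)
  abstractApp-≤ h e (s ⊗ t)   = ℕₚ.+-mono-≤ (abstractApp-≤ h e s) (abstractApp-≤ h e t)
  abstractApp-≤ h e (app g t) with em {g ≡ h × t ≡ embed e}
  ... | yes _ = ℕ.z≤n
  ... | no _  = s≤s (abstractApp-≤ h e t)

  abstractApp-< : ∀ {n} h e (t : Term Symbol n) → innermost t ≡ inj₂ (h , e) →
                  applications (abstractApp h e t) ℕ.< applications t
  abstractApp-< h e (s ⊕ t) found with innermost s in eqs | innermost t in eqt
  abstractApp-< h e (s ⊕ t) refl | inj₂ _ | _ =
    ℕₚ.+-mono-<-≤ (abstractApp-< h e s eqs) (abstractApp-≤ h e t)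
  abstractApp-< h e (s ⊕ t) refl | inj₁ _ | inj₂ _ =
    ℕₚ.+-mono-≤-< (abstractApp-≤ h e s) (abstractApp-< h e t eqt)
  abstractApp-< h e (s ⊗ t) found with innermost s in eqs | innermost t in eqt
  abstractApp-< h e (s ⊗ t) refl | inj₂ _ | _ =
    ℕₚ.+-mono-<-≤ (abstractApp-< h e s eqs) (abstractApp-≤ h e t)
  abstractApp-< h e (s ⊗ t) refl | inj₁ _ | inj₂ _ =
    ℕₚ.+-mono-≤-< (abstractApp-≤ h e s) (abstractApp-< h e t eqt)
  abstractApp-< h e (app g t) found with em {g ≡ h × t ≡ embed e} | innermost t in eqt
  ... | yes _ | _ = s≤s ℕ.z≤n
  abstractApp-< h e (app g t) refl | no _  | inj₂ _ = s≤s (abstractApp-< h e t eqt)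
  abstractApp-< h e (app g t) refl | no ¬p | inj₁ _ = ⊥-elim (¬p (refl , innermost-embed t eqt))

  -- F(e) - δ ≤ w ∧ w ≤ F(e) + δ, with w the most recent variable and the abbreviation
  -- F(e) expanded.

  near : ∀ {n} → Definable → Term ⊥ n → ℚ → FOLℝ (suc n)
  near F e δ =
    EX (subᶠ (var zero Vector.∷ wk 2 e Vector.∷ Vector.[]) (graph F) ⋏
        cmp le (var zero ⊕ con (ℚ.- δ)) (var (suc zero)) ⋏
        cmp le (var (suc zero)) (var zero ⊕ con δ))

  module _ {n} (q : Quantifier) (r : Strictness) (φ : Bounded n)
           (𝓕 : Approximation φ) (δ : ℚ) where

    -- σ undoes the replacements made so far, that is, a term θ of the current scope
    -- stands for the term sub σ θ of φ, and is approximated like it.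

    perturbAtom : ∀ {K} → (Fin K → Term Symbol (scope φ)) → (t : Term Symbol K) →
                  ∀ k → applications t ℕ.≤ k → FOLℝ K
    perturbAtom σ t k t≤k with innermost t in found
    perturbAtom σ t k       t≤k | inj₁ p       = cmp (comparison r) p (con 0ℚ)
    perturbAtom σ t zero    t≤0 | inj₂ (h , e) =
      ⊥-elim (ℕₚ.n≮0 (ℕₚ.<-≤-trans (abstractApp-< h e t found) t≤0))
    perturbAtom σ t (suc k) t≤k | inj₂ (h , e) =
      bound q (near (𝓕 h e′) e δ)
        (perturbAtom (app h e′ Vector.∷ σ) (abstractApp h e t) k
          (s≤s⁻¹ (ℕₚ.<-≤-trans (abstractApp-< h e t found) t≤k)))
      where e′ = sub σ (embed e)

    perturb : FOLℝ n
    perturb =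
      close (prefix φ) (mapCNF (λ t → perturbAtom var t (applications t) ℕₚ.≤-refl) (matrix φ))

  𝓐∀ 𝓐∃ : ∀ {n} → Strictness → (φ : Bounded n) → Approximation φ → ℚ → FOLℝ n
  𝓐∀ = perturb forAll
  𝓐∃ = perturb exists

  InBox : ∀ {n} → Domain n → State n → Set
  InBox D ω = ∀ i → ω i ∈ᴵ D i

  ⟦_⟧ : ∀ {n} → Formula Symbol first-order n → Domain n → Pred (State n) 0ℓ
  ⟦ P ⟧ D ω = InBox D ω × Sat interpretation P ω

  ⟦_⟧FOL : ∀ {n} → FOLℝ n → Domain n → Pred (State n) 0ℓ
  ⟦ P ⟧FOL D ω = InBox D ω × SatFOL P ω

  -- An enclosure I and a sequence (𝓕 δ) of I admissible approximations, indexed by a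
  -- sequence of rationals δ tending to 0.

  record AdmissibleSequence {n} (φ : Bounded n) (D : Domain n) : Set where
    field
      I           : Term Symbol (scope φ) → IQ
      isEnclosure : IsEnclosure φ I
      extends     : Extends φ I D
      δ           : ℕ → ℚ
      δ-positive  : ∀ i → 0ℚ ℚ.< δ i
      δ-small     : ∀ i → δ i ℚ.< ½
      δ→0         : ∀ ε → 0ℚ ℚ.< ε → Σ[ m ∈ ℕ ] (∀ i → m ℕ.≤ i → δ i ℚ.< ε)
      𝓕           : ℚ → Approximation φ
      admissible  : ∀ i → Admissible φ I (δ i) (𝓕 (δ i))

  open BoundedPure
  open AdmissibleSequence

  ∀-Robust : ∀ {r n} → BoundedPure r n → Domain n → Set
  ∀-Robust {r} φ D = Σ[ S ∈ AdmissibleSequence (bounded φ) D ]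
    (⟦ formula r (bounded φ) ⟧ D ≐
     ⋃ ℕ (λ i → ⟦ 𝓐∀ r (bounded φ) (𝓕 S (δ S i)) (δ S i) ⟧FOL D))

  ∃-Robust : ∀ {r n} → BoundedPure r n → Domain n → Set
  ∃-Robust {r} φ D = Σ[ S ∈ AdmissibleSequence (bounded φ) D ]
    (⟦ formula r (bounded φ) ⟧ D ≐
     ⋂ ℕ (λ i → ⟦ 𝓐∃ r (bounded φ) (𝓕 S (δ S i)) (δ S i) ⟧FOL D))

{-# OPTIONS --safe #-}

-- The quantifiers of a bounded formula range over compact intervals with continuous
-- bounds, and the interpreted symbols are differentiable, hence uniformly continuous on
-- compact intervals.  So if a strict formula is true at a point, compactness yields an
-- ε > 0 such that it stays true there with every atom t > 0 replaced by t ≥ ε; dually, if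
-- a weak formula is false at a point, it stays false with t ≥ 0 replaced by t ≥ - ε for
-- some ε > 0.  Uniform continuity of the terms on the enclosure bounds the effect of a
-- perturbation: for small δ, replacing the applications h(e) in t by values within δ of
-- an approximation of h changes t by less than ε, uniformly in the box.  As h(e) itself is
-- an admissible value, the universal perturbations are at least as strong as the formula
-- and the existential ones at most as strong.  The approximations are step functions with
-- rational cuts and values, which FOLℝ defines.

module Submission where

open import Level using (0ℓ)
import Algebra.Properties.Ring as RingProperties
import Algebra.Properties.Semiring.Mult as Multiples
import Algebra.Solver.Ring as RingSolver
open import Algebra.Solver.Ring.AlmostCommutativeRing
  using (fromCommutativeRing; _-Raw-AlmostCommutative⟶_)
open import Axiom.ExcludedMiddle using (ExcludedMiddle)
open import Data.Empty using (⊥; ⊥-elim)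
open import Data.Fin.Base using (Fin; zero; suc)
open import Data.Integer.Base as ℤ using (ℤ)
import Data.Integer.Properties as ℤₚ
open import Data.List.Base using ([]; _∷_)
open import Data.List.Relation.Unary.All as All using (All)
import Data.List.Relation.Unary.All.Properties as Allₚ
open import Data.Maybe.Base using (Maybe; just; nothing)
open import Data.Nat.Base as ℕ using (ℕ; zero; suc; s≤s; s≤s⁻¹)
open import Data.Nat.Coprimality as Coprimality using (1-coprimeTo)
import Data.Nat.Properties as ℕₚ
open import Data.Product.Base using (Σ-syntax; _×_; _,_; proj₁; proj₂)
open import Data.Rational.Base as ℚ using (ℚ; mkℚ; 0ℚ; ½)
import Data.Rational.Properties as ℚₚ
open import Data.Sum.Base using (_⊎_; inj₁; inj₂; [_,_]′)
open import Data.Sum.Properties using (inj₂-injective)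
open import Data.Unit.Base using (⊤; tt)
import Data.Vec.Functional as Vector
open import Function.Base using (_∘_)
open import Relation.Binary.PropositionalEquality as ≡ using (_≡_)
open import Relation.Binary.Structures using (IsTotalOrder)
import Relation.Binary.Construct.NonStrictToStrict as NonStrictToStrict
open import Relation.Nullary using (¬_; yes; no)
open import Relation.Nullary.Decidable using (decidable-stable)
open import Relation.Unary using (_≐_; ⋃; ⋂)
open import Defs

-- The perturbation of an atom replaces one application at a time by a variable, in a growing scope.
-- `Outcome` collects the values that its final function-free term can take, so both kinds of
-- perturbation become statements about one relation in which neither quantifier nor comparison
-- occurs. Along the recursion a state `ω₀` of the scope of the matrix is the fixed point of
-- reference, and `σ` tells which term each variable stands for; the current state stays in the box
-- `enclosure B ∘ σ`. A new variable deviates from `h` at the current argument by up to `δ` for the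
-- approximation and `δ` for the interval around it. As `δ + δ ≤ 1`, this stays within the slack of
-- 1 that an enclosure leaves around `h(e)`, so outcomes never leave the region where uniform
-- continuity is available. Approximations at different indices are unrelated, and the perturbations
-- need not be monotone in the index. One inclusion is therefore proved at every index, the other at
-- a single index chosen from the margin at the given point. Genuine intervals matter where a point
-- of one range is moved to a nearby point of another range, which must be nonempty.

module _ (em : ExcludedMiddle 0ℓ) (ℝ : CompleteOrderedField) where

  open Classical em ℝ
  open CompleteOrderedField ℝ hiding (zero)
  open NonStrictToStrict _≈_ _≤_ using (_<_)
  open Multiples semiring using (×-homo-+; ×1-homo-*) renaming (_×_ to _·_)
  open RingProperties ring using (-0#≈0#; -‿involutive; -‿distribˡ-*; -‿distribʳ-*; -‿+-comm)
  open Definable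
  open Bounded

  -- The ring solver

  fromℤ-neg : ∀ i → fromℤ (ℤ.- i) ≈ - fromℤ i
  fromℤ-neg (ℤ.+ zero)    = sym -0#≈0#
  fromℤ-neg (ℤ.+ (suc n)) = refl
  fromℤ-neg ℤ.-[1+ n ]    = sym (-‿involutive _)

  fromℤ-⊖ : ∀ m n → fromℤ (m ℤ.⊖ n) ≈ m · 1# - n · 1#
  fromℤ-⊖ m zero = sym (trans (+-congˡ -0#≈0#) (+-identityʳ _))
  fromℤ-⊖ zero (suc n) = sym (+-identityˡ _)
  fromℤ-⊖ (suc m) (suc n) rewrite ℤₚ.[1+m]⊖[1+n]≡m⊖n m n = trans (fromℤ-⊖ m n) (sym (begin
    (1# + a) - (1# + b)      ≈⟨ +-congˡ (-‿+-comm 1# b) ⟨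
    (1# + a) + (- 1# + - b)  ≈⟨ +-congʳ (+-comm 1# a) ⟩
    (a + 1#) + (- 1# + - b)  ≈⟨ +-assoc a 1# _ ⟩
    a + (1# + (- 1# + - b))  ≈⟨ +-congˡ (+-assoc 1# _ _) ⟨
    a + ((1# - 1#) + - b)    ≈⟨ +-congˡ (+-congʳ (-‿inverseʳ 1#)) ⟩
    a + (0# + - b)           ≈⟨ +-congˡ (+-identityˡ _) ⟩
    a - b                    ∎))
    where
    open import Relation.Binary.Reasoning.Setoid setoid
    a = m · 1#
    b = n · 1#

  fromℤ-+ : ∀ i j → fromℤ (i ℤ.+ j) ≈ fromℤ i + fromℤ j
  fromℤ-+ (ℤ.+ m) (ℤ.+ n)       = ×-homo-+ 1# m n
  fromℤ-+ (ℤ.+ m) ℤ.-[1+ n ]    = fromℤ-⊖ m (suc n)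
  fromℤ-+ ℤ.-[1+ m ] (ℤ.+ n)    = trans (fromℤ-⊖ n (suc m)) (+-comm _ _)
  fromℤ-+ ℤ.-[1+ m ] ℤ.-[1+ n ] = trans
    (-‿cong (trans (reflexive (≡.cong (_· 1#) (≡.sym (ℕₚ.+-suc (suc m) n))))
        (×-homo-+ 1# (suc m) (suc n))))
    (sym (-‿+-comm _ _))

  fromℤ-* : ∀ i j → fromℤ (i ℤ.* j) ≈ fromℤ i * fromℤ j
  fromℤ-* (ℤ.+ m) (ℤ.+ n) rewrite ℤₚ.+◃n≡+n (m ℕ.* n) = ×1-homo-* m n
  fromℤ-* (ℤ.+ m) ℤ.-[1+ n ] rewrite ℤₚ.-◃n≡-n (m ℕ.* suc n) =
    trans (fromℤ-neg (ℤ.+ (m ℕ.* suc n))) (trans (-‿cong (×1-homo-* m (suc n))) (-‿distribʳ-* _ _))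
  fromℤ-* ℤ.-[1+ m ] (ℤ.+ n) rewrite ℤₚ.-◃n≡-n (suc m ℕ.* n) =
    trans (fromℤ-neg (ℤ.+ (suc m ℕ.* n))) (trans (-‿cong (×1-homo-* (suc m) n)) (-‿distribˡ-* _ _))
  fromℤ-* ℤ.-[1+ m ] ℤ.-[1+ n ] = trans (×1-homo-* (suc m) (suc n))
    (trans (sym (-‿involutive _)) (trans (-‿cong (-‿distribʳ-* _ _)) (-‿distribˡ-* _ _)))

  -- The solver takes integer coefficients because their equality is decided by computation, while
  -- equality in the field is decided only by `em`.
  fromℤ-homomorphism : ℤ.+-*-rawRing -Raw-AlmostCommutative⟶ fromCommutativeRing commutativeRing
  fromℤ-homomorphism = record
    { ⟦_⟧    = fromℤ
    ; +-homo = fromℤ-+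
    ; *-homo = fromℤ-*
    ; -‿homo = fromℤ-neg
    ; 0-homo = refl
    ; 1-homo = +-identityʳ 1#
    }

  fromℤ-≟ : ∀ i j → Maybe (fromℤ i ≈ fromℤ j)
  fromℤ-≟ i j with i ℤₚ.≟ j
  ... | yes ≡.refl = just refl
  ... | no _       = nothing

  open RingSolver ℤ.+-*-rawRing (fromCommutativeRing commutativeRing) fromℤ-homomorphism fromℤ-≟
    using (solve; _:=_; _:+_; _:*_; _:-_; :-_; con)

  -- Ordered fields

  module ≤ = IsTotalOrder isTotalOrder
  module < = NonStrictToStrict _≈_ _≤_

  ≤-refl : ∀ {x} → x ≤ x
  ≤-refl = ≤.refl

  <⇒≱ : ∀ {x y} → x < y → ¬ (y ≤ x)
  <⇒≱ = <.<⇒≱ ≤.antisym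

  ≰⇒> : ∀ {x y} → ¬ (x ≤ y) → y < x
  ≰⇒> = <.≰⇒> sym ≤.reflexive ≤.total

  <-≤-trans : ∀ {x y z} → x < y → y ≤ z → x < z
  <-≤-trans = <.<-≤-trans sym ≤.trans ≤.antisym ≤.≤-respʳ-≈

  ≤-<-trans : ∀ {x y z} → x ≤ y → y < z → x < z
  ≤-<-trans = <.≤-<-trans ≤.trans ≤.antisym ≤.≤-respˡ-≈

  ≮⇒≥ : ∀ {x y} → ¬ (x < y) → y ≤ x
  ≮⇒≥ {x} {y} x≮y = decidable-stable em λ y≰x → x≮y (≰⇒> y≰x)

  +-mono-≤ : ∀ {a b c d} → a ≤ b → c ≤ d → a + c ≤ b + d
  +-mono-≤ {a} {b} {c} {d} a≤b c≤d = ≤.trans (+-monoˡ-≤ c a≤b)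
    (≤.≤-respʳ-≈ (+-comm d b) (≤.≤-respˡ-≈ (+-comm c b) (+-monoˡ-≤ b c≤d)))

  -- Linear arithmetic modulo ring identities, with y - x ≈ r - l stated without subtraction.
  linear : ∀ {l r x y} → l ≤ r → x + r ≈ y + l → x ≤ y
  linear {l} {r} {x} {y} l≤r bal =
    ≤.≤-respʳ-≈ (cancel y l) (≤.≤-respˡ-≈ (cancel x l) (+-monoˡ-≤ (- l)
      (≤.trans (+-mono-≤ ≤-refl l≤r) (≤.reflexive bal))))
    where
    cancel : ∀ a b → a + b - b ≈ a
    cancel = solve 2 (λ a b → a :+ b :- b := a) refl

  linear-< : ∀ {l r x y} → l < r → x + r ≈ y + l → x < y
  linear-< {l} {r} {x} {y} l<r bal = ≰⇒> λ y≤x → <⇒≱ l<r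
    (linear y≤x (trans (+-comm r x) (trans bal (+-comm y l))))

  nonneg⇒≤ : ∀ {d x y} → 0# ≤ d → y ≈ x + d → x ≤ y
  nonneg⇒≤ 0≤d bal = linear 0≤d (trans (sym bal) (sym (+-identityʳ _)))

  ≤⇒nonneg : ∀ {x y} → x ≤ y → 0# ≤ y - x
  ≤⇒nonneg {x} {y} x≤y = linear x≤y (solve 2 (λ x y → con (ℤ.+ 0) :+ y := y :- x :+ x) refl x y)

  -- Halving without division: if `b < a`, then `a + a ≤ b + b ≤ a + b`, and `a` cancels.
  double : ∀ {a b} → a + a ≤ b + b → a ≤ b
  double {a} {b} h = decidable-stable em λ a≰b →
    let b<a = ≰⇒> a≰b in
    a≰b (linear (≤.trans h (+-monoˡ-≤ b (proj₁ b<a)))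
      (solve 2 (λ a b → a :+ (a :+ b) := b :+ (a :+ a)) refl a b))

  *-monoʳ-≤ : ∀ {a b c} → 0# ≤ c → a ≤ b → a * c ≤ b * c
  *-monoʳ-≤ {a} {b} {c} 0≤c a≤b = nonneg⇒≤ (*-nonneg (≤⇒nonneg a≤b) 0≤c)
    (solve 3 (λ a b c → b :* c := a :* c :+ (b :- a) :* c) refl a b c)

  *-monoˡ-≤ : ∀ {a b c} → 0# ≤ c → a ≤ b → c * a ≤ c * b
  *-monoˡ-≤ {a} {b} {c} 0≤c a≤b =
    ≤.≤-respʳ-≈ (*-comm b c) (≤.≤-respˡ-≈ (*-comm a c) (*-monoʳ-≤ 0≤c a≤b))

  0<1 : 0# < 1#
  0<1 = [ (λ 0≤1 → 0≤1) , (λ 1≤0 → square (≤⇒nonneg 1≤0)) ]′ (≤.total 0# 1#) , 0≉1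
    where
    square : 0# ≤ 0# - 1# → 0# ≤ 1#
    square 0≤-1 = nonneg⇒≤ (*-nonneg 0≤-1 0≤-1) (trans (sym (*-identityʳ 1#))
      (solve 1 (λ u → u :* u := con (ℤ.+ 0) :+ (con (ℤ.+ 0) :- u) :* (con (ℤ.+ 0) :- u)) refl 1#))

  0≤1 : 0# ≤ 1#
  0≤1 = proj₁ 0<1

  0<+ : ∀ {a b} → 0# < a → 0# ≤ b → 0# < a + b
  0<+ {a} {b} 0<a 0≤b = <-≤-trans 0<a (nonneg⇒≤ 0≤b refl)

  >⇒≉0 : ∀ {a} → 0# < a → ¬ (a ≈ 0#)
  >⇒≉0 0<a a≈0 = proj₂ 0<a (sym a≈0)

  0<⁻¹ : ∀ {a} → 0# < a → 0# < a ⁻¹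
  0<⁻¹ {a} 0<a = ≰⇒> λ a⁻¹≤0 → <⇒≱ 0<1
    (≤.≤-respʳ-≈ (zeroʳ a) (≤.≤-respˡ-≈ (*-inverseʳ a (>⇒≉0 0<a)) (*-monoˡ-≤ (proj₁ 0<a) a⁻¹≤0)))

  cancelʳ : ∀ {a} b → 0# < a → b * a ⁻¹ * a ≈ b
  cancelʳ {a} b 0<a = trans (*-assoc b _ a) (trans (*-congˡ (trans (*-comm _ a)
    (*-inverseʳ a (>⇒≉0 0<a)))) (*-identityʳ b))

  0<* : ∀ {a b} → 0# < a → 0# < b → 0# < a * b
  0<* {a} {b} 0<a 0<b = *-nonneg (proj₁ 0<a) (proj₁ 0<b) , λ 0≈ab → proj₂ 0<a
    (trans (sym (zeroˡ _)) (trans (*-congʳ 0≈ab)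
        (trans (solve 3 (λ a b c → a :* b :* c := a :* c :* b) refl a b (b ⁻¹))
      (cancelʳ a 0<b))))

  -- `M` may be zero or negative: for `M ≤ 1#` the number `ε` itself serves, and only an `M ≥ 1#` is
  -- inverted.
  scale : ∀ {ε} M → 0# < ε → Σ[ η ∈ Carrier ] 0# < η × η * M ≤ ε
  scale {ε} M 0<ε = [ (λ M≤1 → ε , 0<ε , ≤.≤-respʳ-≈ (*-identityʳ ε) (*-monoˡ-≤ (proj₁ 0<ε) M≤1))
                    , (λ 1≤M → let 0<M = <-≤-trans 0<1 1≤M in
                         ε * M ⁻¹ , 0<* 0<ε (0<⁻¹ 0<M) , ≤.reflexive (cancelʳ ε 0<M)) ]′
                             (≤.total M 1#)

  half : ∀ {ε} → 0# < ε → Σ[ η ∈ Carrier ] 0# < η × η + η ≤ ε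
  half 0<ε = let η , 0<η , h = scale (1# + 1#) 0<ε in
    η , 0<η , ≤.≤-respˡ-≈ (trans (distribˡ η 1# 1#) (+-cong (*-identityʳ η) (*-identityʳ η))) h

  lower : ∀ {a b} → 0# < a → 0# < b → Σ[ c ∈ Carrier ] 0# < c × c ≤ a × c ≤ b
  lower {a} {b} 0<a 0<b = [ (λ a≤b → a , 0<a , ≤-refl , a≤b) ,
      (λ b≤a → b , 0<b , b≤a , ≤-refl) ]′ (≤.total a b)

  upper : ∀ a b → Σ[ c ∈ Carrier ] a ≤ c × b ≤ c
  upper a b = [ (λ a≤b → b , a≤b , ≤-refl) , (λ b≤a → a , ≤-refl , b≤a) ]′ (≤.total a b)

  -- `∣ x ∣` is a case split on the order; two linear inequalities combine directly with `linear`
  -- and the ring solver. The same holds for `Close`.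
  Bounded-by : Carrier → Carrier → Set
  Bounded-by M x = x ≤ M × - x ≤ M

  Close : Carrier → Carrier → Carrier → Set
  Close ε x y = x ≤ y + ε × y ≤ x + ε

  neg-≤ : ∀ {x y} → - x ≤ y → - y ≤ x
  neg-≤ {x} {y} h = linear h (solve 2 (λ x y → :- y :+ y := x :+ :- x) refl x y)

  neg-antitone : ∀ {x y} → x ≤ y → - y ≤ - x
  neg-antitone {x} {y} h = linear h (solve 2 (λ x y → :- y :+ y := :- x :+ x) refl x y)

  close-sym : ∀ {ε x y} → Close ε x y → Close ε y x
  close-sym (p , q) = q , p

  close-refl : ∀ {ε x} → 0# ≤ ε → Close ε x x
  close-refl {ε} {x} 0≤ε = nonneg⇒≤ 0≤ε refl , nonneg⇒≤ 0≤ε refl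

  close-≈ : ∀ {ε x y} → 0# ≤ ε → x ≈ y → Close ε x y
  close-≈ 0≤ε x≈y = ≤.≤-respˡ-≈ (sym x≈y) (nonneg⇒≤ 0≤ε refl) ,
      ≤.≤-respʳ-≈ (+-congʳ (sym x≈y)) (nonneg⇒≤ 0≤ε refl)

  close-mono : ∀ {ε η x y} → ε ≤ η → Close ε x y → Close η x y
  close-mono ε≤η (p , q) = ≤.trans p (+-mono-≤ ≤-refl ε≤η) , ≤.trans q (+-mono-≤ ≤-refl ε≤η)

  close-trans : ∀ {ε η x y z} → Close ε x y → Close η y z → Close (ε + η) x z
  close-trans {ε} {η} {x} {y} {z} (p , q) (p′ , q′) =
    linear (+-mono-≤ p p′) (solve 5
        (λ x y z e h → x :+ ((y :+ e) :+ (z :+ h)) := z :+ (e :+ h) :+ (x :+ y)) refl x y z ε η) ,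
    linear (+-mono-≤ q q′) (solve 5
        (λ x y z e h → z :+ ((x :+ e) :+ (y :+ h)) := x :+ (e :+ h) :+ (y :+ z)) refl x y z ε η)

  close-+ : ∀ {ε η x y x′ y′} → Close ε x y → Close η x′ y′ → Close (ε + η) (x + x′) (y + y′)
  close-+ {ε} {η} {x} {y} {x′} {y′} (p , q) (p′ , q′) =
    ≤.≤-respʳ-≈ (rearrange y ε y′ η) (+-mono-≤ p p′) ,
        ≤.≤-respʳ-≈ (rearrange x ε x′ η) (+-mono-≤ q q′)
    where
    rearrange : ∀ a b c d → (a + b) + (c + d) ≈ a + c + (b + d)
    rearrange = solve 4 (λ a b c d → (a :+ b) :+ (c :+ d) := a :+ c :+ (b :+ d)) refl

  0≤+ : ∀ {a b} → 0# ≤ a → 0# ≤ b → 0# ≤ a + b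
  0≤+ 0≤a 0≤b = ≤.trans 0≤a (nonneg⇒≤ 0≤b refl)

  -- Without cases on signs: `(e - a) (M + b) + (e + a) (M - b)` equals twice `e M - a b`, and all
  -- four factors are nonnegative.
  *-bound : ∀ {a b e M} → Bounded-by e a → Bounded-by M b → a * b ≤ e * M
  *-bound {a} {b} {e} {M} (a≤e , -a≤e) (b≤M , -b≤M) = double (nonneg⇒≤
    (0≤+ (*-nonneg (≤⇒nonneg a≤e) (≤⇒nonneg -b≤M)) (*-nonneg (≤⇒nonneg -a≤e) (≤⇒nonneg b≤M)))
    (solve 4 (λ a b e M → e :* M :+ e :* M :=
       (a :* b :+ a :* b) :+ ((e :- a) :* (M :- (:- b)) :+ (e :- (:- a)) :* (M :- b))) refl a b e
           M))

  bounded-neg : ∀ {M x} → Bounded-by M x → Bounded-by M (- x)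
  bounded-neg {M} {x} (p , q) = q , ≤.≤-respˡ-≈ (solve 1 (λ x → x := :- (:- x)) refl x) p

  bounded-mono : ∀ {M N x} → M ≤ N → Bounded-by M x → Bounded-by N x
  bounded-mono M≤N (p , q) = ≤.trans p M≤N , ≤.trans q M≤N

  bounded-+ : ∀ {M N x y} → Bounded-by M x → Bounded-by N y → Bounded-by (M + N) (x + y)
  bounded-+ {x = x} {y} (p , q) (p′ , q′) = +-mono-≤ p p′ ,
    ≤.≤-respˡ-≈ (solve 2 (λ x y → :- x :+ :- y := :- (x :+ y)) refl x y) (+-mono-≤ q q′)

  bounded-* : ∀ {M N x y} → Bounded-by M x → Bounded-by N y → Bounded-by (M * N) (x * y)
  bounded-* {x = x} {y} p q = *-bound p q ,
    ≤.≤-respˡ-≈ (solve 2 (λ x y → (:- x) :* y := :- (x :* y)) refl x y) (*-bound (bounded-neg p) q)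

  close⇒bounded : ∀ {ε x y} → Close ε x y → Bounded-by ε (x - y)
  close⇒bounded {ε} {x} {y} (p , q) =
    linear p (solve 3 (λ x y e → x :- y :+ (y :+ e) := e :+ x) refl x y ε) ,
    linear q (solve 3 (λ x y e → (:- (x :- y)) :+ (x :+ e) := e :+ y) refl x y ε)

  bounded⇒close : ∀ {ε x y} → Bounded-by ε (x - y) → Close ε x y
  bounded⇒close {ε} {x} {y} (p , q) =
    linear p (solve 3 (λ x y e → x :+ e := y :+ e :+ (x :- y)) refl x y ε) ,
    linear q (solve 3 (λ x y e → y :+ e := x :+ e :+ (:- (x :- y))) refl x y ε)

  -- From `x x′ - y y′ = x (x′ - y′) + (x - y) y′`, which is why one bound is on `x` and the other
  -- on `y′`.
  close-* : ∀ {ε η M N x y x′ y′} → Bounded-by M x → Bounded-by N y′ →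
            Close ε x y → Close η x′ y′ → Close (M * η + ε * N) (x * x′) (y * y′)
  close-* {x = x} {y} {x′} {y′} ∣x∣≤M ∣y′∣≤N x~y x′~y′ =
    let p , q = bounded-+ (bounded-* ∣x∣≤M (close⇒bounded x′~y′))
            (bounded-* (close⇒bounded x~y) ∣y′∣≤N)
        d = solve 4 (λ x y x′ y′ → x :* (x′ :- y′) :+ (x :- y) :* y′ := x :* x′ :- y :* y′) refl x
            y x′ y′
    in bounded⇒close (≤.≤-respˡ-≈ d p , ≤.≤-respˡ-≈ (-‿cong d) q)

  abs-bounded : ∀ {M x} → ∣ x ∣ ≤ M → Bounded-by M x
  abs-bounded {M} {x} h with ≤.total 0# x
  ... | inj₁ 0≤x = h , ≤.trans (linear (+-mono-≤ 0≤x 0≤x)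
         (solve 1 (λ x → (:- x) :+ (x :+ x) := x :+ (con (ℤ.+ 0) :+ con (ℤ.+ 0))) refl x)) h
  ... | inj₂ x≤0 = ≤.trans (linear (+-mono-≤ x≤0 x≤0)
         (solve 1 (λ x → x :+ (con (ℤ.+ 0) :+ con (ℤ.+ 0)) := (:- x) :+ (x :+ x)) refl x)) h , h

  bounded-abs : ∀ {M x} → Bounded-by M x → ∣ x ∣ ≤ M
  bounded-abs {M} {x} (p , q) with ≤.total 0# x
  ... | inj₁ _ = p
  ... | inj₂ _ = q

  abs-bounds : ∀ x → Bounded-by ∣ x ∣ x
  abs-bounds x = abs-bounded ≤-refl

  0≤abs : ∀ x → 0# ≤ ∣ x ∣
  0≤abs x = let p , q = abs-bounds x in double (≤.≤-respˡ-≈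
    (solve 1 (λ x → x :+ :- x := con (ℤ.+ 0) :+ con (ℤ.+ 0)) refl x) (+-mono-≤ p q))

  -- Completeness and compactness

  -- Otherwise `x` bounds all `n · 1#`, so they have a supremum `s`. Every successor is at most `s`,
  -- hence `s - 1#` is a smaller upper bound.
  archimedes : ∀ x → Σ[ n ∈ ℕ ] x ≤ n · 1#
  archimedes x = decidable-stable em λ none →
    let s , ub , least = complete (λ y → Σ[ n ∈ ℕ ] y ≈ n · 1#) (0# , 0 , refl)
          (x , λ { y (n , y≈n) → [ (λ y≤x → y≤x) ,
              (λ x≤y → ⊥-elim (none (n , ≤.≤-respʳ-≈ y≈n x≤y))) ]′ (≤.total y x) })
        s≤s-1 = least (s - 1#) λ { y (n , y≈n) → ≤.≤-respˡ-≈ (sym y≈n)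
          (linear (ub (suc n · 1#) (suc n , refl))
              (solve 3 (λ n s u → n :+ s := s :- u :+ (u :+ n)) refl (n · 1#) s 1#)) }
    in <⇒≱ 0<1 (linear s≤s-1 (solve 2 (λ s u → u :+ (s :- u) := con (ℤ.+ 0) :+ s) refl s 1#))

  floor : ∀ N {x} → 0# ≤ x → x < N · 1# → Σ[ n ∈ ℕ ] n · 1# ≤ x × x < suc n · 1#
  floor zero    0≤x x<0 = ⊥-elim (<⇒≱ x<0 0≤x)
  floor (suc N) {x} 0≤x x<1+N with em {N · 1# ≤ x}
  ... | yes N≤x = N , N≤x , x<1+N
  ... | no N≰x  = floor N 0≤x (≰⇒> N≰x)

  n<1+n : ∀ n → n · 1# < suc n · 1#
  n<1+n n = linear-< 0<1 (solve 2 (λ n u → n :+ u := u :+ n :+ con (ℤ.+ 0)) refl (n · 1#) 1#)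

  0≤n : ∀ n → 0# ≤ n · 1#
  0≤n zero    = ≤-refl
  0≤n (suc n) = ≤.trans (0≤n n) (proj₁ (n<1+n n))

  archimedes-< : ∀ x → Σ[ n ∈ ℕ ] x < n · 1#
  archimedes-< x = let n , x≤n = archimedes x in suc n , ≤-<-trans x≤n (n<1+n n)

  -- The rational number (p - q) / n lies strictly between u and v.
  density : ∀ {u v} → u < v → Σ[ n ∈ ℕ ] Σ[ p ∈ ℕ ] Σ[ q ∈ ℕ ]
    (0# < n · 1# × n · 1# * u + q · 1# < p · 1# × p · 1# < n · 1# * v + q · 1#)
  density {u} {v} u<v =
    let d = v - u
        0<d = linear-< u<v (solve 2 (λ u v → con (ℤ.+ 0) :+ v := v :- u :+ u) refl u v)
        -- The additional `1#` makes `n d ≥ 1 + d` exceed 1 strictly, so an integer fits strictly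
        -- between `n u` and `n v`.
        n , n-large = archimedes (d ⁻¹ + 1#)
        0<n = <-≤-trans (0<+ (0<⁻¹ 0<d) 0≤1) n-large
        -- The shift by `q` makes `n u + q` nonnegative, as `floor` searches only natural numbers.
        q , q-large = archimedes (- (n · 1# * u))
        1<nd = <-≤-trans (linear-< 0<d
            (solve 2 (λ u d → u :+ d := u :+ d :+ con (ℤ.+ 0)) refl 1# d))
          (≤.≤-respˡ-≈ (trans (distribʳ d _ 1#)
              (+-cong (trans (*-comm _ _) (*-inverseʳ d (>⇒≉0 0<d))) (*-identityˡ d)))
            (*-monoʳ-≤ (proj₁ 0<d) n-large))
        0≤nu+q = linear q-large (solve 2 (λ a q → con (ℤ.+ 0) :+ q := a :+ q :+ :- a)
            refl (n · 1# * u) (q · 1#))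
        N , N-large = archimedes-< (n · 1# * u + q · 1#)
        m , m≤ , <1+m = floor N 0≤nu+q N-large
    in n , suc m , q , 0<n , <1+m ,
       ≤-<-trans (+-mono-≤ ≤-refl m≤) (linear-< 1<nd
         (solve 5 (λ o n u v q → o :+ (n :* u :+ q) :+ n :* (v :- u) := n :* v :+ q :+ o) refl 1#
             (n · 1#) u v (q · 1#)))

  -- If `P` failed at `b`, its supremum `s` would lie in the interval, and the step would carry `P`
  -- beyond `s`. The step starts from any `t` above `s - η` because the supremum itself need not
  -- satisfy `P`.
  real-induction : (P : Carrier → Set) → (∀ {s t} → s ≤ t → P t → P s) → ∀ {a b} → P a →
    (∀ s → a ≤ s → s ≤ b → Σ[ η ∈ Carrier ] 0# < η × (∀ t → s < t + η → P t → P (s + η))) → P b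
  real-induction P P-lower {a} {b} Pa step = decidable-stable em λ ¬Pb →
    let below x Px = [ (λ x≤b → x≤b) , (λ b≤x → ⊥-elim (¬Pb (P-lower b≤x Px))) ]′ (≤.total x b)
        s , ub , least = complete P (a , Pa) (b , below)
        η , 0<η , extend = step s (ub a Pa) (least b below)
        near = decidable-stable em λ (none : ¬ (Σ[ t ∈ Carrier ] s < t + η × P t)) →
          <⇒≱ 0<η (linear (least (s - η) (λ t Pt → linear (≮⇒≥ λ s<t+η → none (t , s<t+η , Pt))
              (solve 3 (λ s t e → t :+ s := s :- e :+ (t :+ e)) refl s t η)))
            (solve 2 (λ s e → e :+ (s :- e) := con (ℤ.+ 0) :+ s) refl s η))
        t , s<t+η , Pt = near
    in <⇒≱ 0<η (linear (ub (s + η) (extend t s<t+η Pt))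
        (solve 2 (λ s e → e :+ s := con (ℤ.+ 0) :+ (s :+ e)) refl s η))

  -- Heine-Borel in directed form. Real induction on the end `t` of the part already covered
  -- replaces the choice of a finite subcover: the index for `y ≤ t` is joined with the local one at
  -- `s`, which covers `t ≤ y ≤ s + η` because `t` is above `s - η`.
  compactness : ∀ {X : Set} (R : X → Carrier → Set) →
    (∀ i j → Σ[ k ∈ X ] (∀ y → R i y → R k y) × (∀ y → R j y → R k y)) → ∀ {a b} → a ≤ b →
    (∀ s → a ≤ s → s ≤ b → Σ[ i ∈ X ] Σ[ η ∈ Carrier ] 0# < η ×
      (∀ y → a ≤ y → y ≤ b → Close η y s → R i y)) →
    Σ[ i ∈ X ] (∀ y → a ≤ y → y ≤ b → R i y)
  compactness {X} R join {a} {b} a≤b local =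
    let i , Ri = real-induction (λ t → Σ[ i ∈ X ] (∀ y → a ≤ y → y ≤ b → y ≤ t → R i y))
          (λ s≤t (i , Ri) → i , λ y a≤y y≤b y≤s → Ri y a≤y y≤b (≤.trans y≤s s≤t))
          (let i , η , 0<η , Ri = local a ≤-refl a≤b in
            i , λ y a≤y y≤b y≤a → Ri y a≤y y≤b (close-≈ (proj₁ 0<η) (≤.antisym y≤a a≤y)))
          (λ s a≤s s≤b → let i , η , 0<η , Ri = local s a≤s s≤b in η , 0<η , λ t s<t+η (j , Rj) →
            let k , i⇒k , j⇒k = join i j in k , λ y a≤y y≤b y≤s+η →
              [ (λ y≤t → j⇒k y (Rj y a≤y y≤b y≤t))
              , (λ t≤y → i⇒k y (Ri y a≤y y≤b (y≤s+η , ≤.trans (proj₁ s<t+η) (+-monoˡ-≤ η t≤y)))) ]′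
                  (≤.total y t))
    in i , λ y a≤y y≤b → Ri y a≤y y≤b y≤b

  -- Continuity of the interpreted symbols

  Positive : Set
  Positive = Σ[ ε ∈ Carrier ] 0# < ε

  Continuous : (Carrier → Carrier) → Set
  Continuous f = ∀ t ε → 0# < ε →
      Σ[ η ∈ Carrier ] 0# < η × (∀ s → Close η s t → Close ε (f s) (f t))

  -- The derivative estimate with error factor 1 makes `f` Lipschitz at `t` with constant
  -- `M = 1# + ∣ d ∣`.
  differentiable⇒continuous : ∀ f → (∀ t → Σ[ d ∈ Carrier ] HasDerivativeAt f d t) → Continuous f
  differentiable⇒continuous f f′ t ε 0<ε =
    let d , deriv = f′ t
        η , 0<η , small = deriv 1# 0<1
        M = 1# + ∣ d ∣
        κ , 0<κ , κM≤ε = scale M 0<ε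
        θ , 0<θ , θ≤η , θ≤κ = lower 0<η 0<κ
    in θ , 0<θ , λ s s~t →
      let ∣s-t∣≤θ = close⇒bounded s~t
          p = abs-bounded (small s (bounded-abs (bounded-mono θ≤η ∣s-t∣≤θ)))
          p′ = bounded-mono (≤.trans (≤.reflexive (*-identityˡ _)) (bounded-abs ∣s-t∣≤θ)) p
          q , r = bounded-+ p′ (bounded-* (abs-bounds d) ∣s-t∣≤θ)
          e = solve 3 (λ a b c → a :- b :- c :+ c := a :- b) refl (f s) (f t) (d * (s - t))
          θM≤ε = ≤.trans (≤.reflexive
              (trans (+-congʳ (sym (*-identityˡ θ)))
              (trans (sym (distribʳ θ 1# ∣ d ∣)) (*-comm M θ))))
                   (≤.trans (*-monoʳ-≤ (≤.trans 0≤1 (nonneg⇒≤ (0≤abs d) refl)) θ≤κ) κM≤ε)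
      in bounded⇒close (bounded-mono θM≤ε (≤.≤-respˡ-≈ e q , ≤.≤-respˡ-≈ (-‿cong e) r))

  -- A symbol without a global solution is interpreted by a constant, so this needs no
  -- soundness of the calculus.
  interpretation-continuous : ∀ h → Continuous (interpretation h)
  interpretation-continuous h with em
      {Σ[ x ∈ (Carrier → State (suc (Symbol.dim h))) ] IsGlobalSolution h x}
  ... | yes (x , _ , solves) = differentiable⇒continuous (λ t → x t zero) (λ t → _ , solves t zero)
  ... | no _ = λ t ε 0<ε → ε , 0<ε , λ s _ → close-refl (proj₁ 0<ε)

  module _ {f : Carrier → Carrier} (continuous : Continuous f) {a b : Carrier} where

    abstract
      uniformly-continuous : ∀ {ε} → 0# < ε → Σ[ η ∈ Carrier ] 0# < η ×
        (∀ x y → a ≤ x → x ≤ b → a ≤ y → y ≤ b → Close η x y → Close ε (f x) (f y))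
      uniformly-continuous {ε} 0<ε with em {a ≤ b}
      ... | no a≰b = ε , 0<ε , λ x y a≤x x≤b _ _ _ → ⊥-elim (a≰b (≤.trans a≤x x≤b))
      ... | yes a≤b =
        let (η , 0<η) , uniform = compactness {Positive}
              (λ (η , _) y → ∀ x → a ≤ x → x ≤ b → Close η x y → Close ε (f x) (f y))
              (λ (η , 0<η) (κ , 0<κ) → let θ , 0<θ , θ≤η , θ≤κ = lower 0<η 0<κ in (θ , 0<θ) ,
                (λ y R x a≤x x≤b c → R x a≤x x≤b (close-mono θ≤η c)) ,
                (λ y R x a≤x x≤b c → R x a≤x x≤b (close-mono θ≤κ c)))
              a≤b
              (λ s a≤s s≤b →
                let ε′ , 0<ε′ , 2ε′≤ε = half 0<ε
                    η , 0<η , near = continuous s ε′ 0<ε′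
                    -- Both `y` and `x` are compared with the centre `s`: `y` is within `η′` of it,
                    -- and `x` within `η′` of `y`.
                    η′ , 0<η′ , 2η′≤η = half 0<η
                    η′≤η = ≤.trans (nonneg⇒≤ (proj₁ 0<η′) refl) 2η′≤η
                in (η′ , 0<η′) , η′ , 0<η′ , λ y a≤y y≤b y~s x a≤x x≤b x~y →
                  close-mono 2ε′≤ε (close-trans (near x (close-mono 2η′≤η (close-trans x~y y~s)))
                    (close-sym (near y (close-mono η′≤η y~s)))))
        in η , 0<η , λ x y a≤x x≤b a≤y y≤b x~y → uniform y a≤y y≤b x a≤x x≤b x~y

      image-bounded : Σ[ M ∈ Carrier ] (∀ x → a ≤ x → x ≤ b → Bounded-by M (f x))
      image-bounded with em {a ≤ b}
      ... | no a≰b = 0# , λ x a≤x x≤b → ⊥-elim (a≰b (≤.trans a≤x x≤b))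
      ... | yes a≤b = compactness (λ M x → Bounded-by M (f x))
        (λ M N → let L , M≤L , N≤L = upper M N in L , (λ _ → bounded-mono M≤L) ,
            (λ _ → bounded-mono N≤L))
        a≤b
        (λ s a≤s s≤b → let η , 0<η , near = continuous s 1# 0<1 in 1# + ∣ f s ∣ , η , 0<η ,
            λ y _ _ y~s →
          let p , q = bounded-+ (close⇒bounded (near y y~s)) (abs-bounds (f s))
              e = solve 2 (λ a b → a :- b :+ b := a) refl (f y) (f s)
          in ≤.≤-respˡ-≈ e p , ≤.≤-respˡ-≈ (-‿cong e) q)

  -- Definable approximations

  integer : ℤ → ℚ
  integer i = mkℚ i 0 (Coprimality.sym (1-coprimeTo _))

  1·-inverse : ∀ x → x * (1 · 1#) ⁻¹ ≈ x
  1·-inverse x = trans (*-congˡ (⁻¹-cong (+-identityʳ 1#)))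
      (trans (sym (*-identityʳ _)) (cancelʳ x 0<1))

  fromℚ-integer : ∀ i → fromℚ (integer i) ≈ fromℤ i
  fromℚ-integer i = 1·-inverse (fromℤ i)

  fromℚ-neg : ∀ c → fromℚ (ℚ.- c) ≈ - fromℚ c
  fromℚ-neg (mkℚ ℤ.-[1+ n ] d _)    =
      trans (*-congʳ (fromℤ-neg ℤ.-[1+ n ])) (sym (-‿distribˡ-* _ _))
  fromℚ-neg (mkℚ (ℤ.+ zero) d _)    =
      trans (*-congʳ (fromℤ-neg (ℤ.+ zero))) (sym (-‿distribˡ-* _ _))
  fromℚ-neg (mkℚ (ℤ.+ (suc n)) d _) = sym (-‿distribˡ-* _ _)

  0≈fromℚ0 : 0# ≈ fromℚ 0ℚ
  0≈fromℚ0 = sym (zeroˡ _)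

  module _ (n p q : ℕ) where

    -- The rational `(p - q) / n` of `density` is used with its denominator cleared, so only integer
    -- constants occur: `piecewise` cuts at `n x + q < p` in the argument, and `constant` solves
    -- `n y + q = p` for the value.
    affine : ∀ {k} → Fin k → Term ⊥ k
    affine i = con (integer (ℤ.+ n)) ⊗ var i ⊕ con (integer (ℤ.+ q))

    affine-value : ∀ {k} i (ω : State k) → polynomial (affine i) ω ≈ n · 1# * ω i + q · 1#
    affine-value i ω = +-cong (*-congʳ (fromℚ-integer (ℤ.+ n))) (fromℚ-integer (ℤ.+ q))

    threshold : ∀ {k} → Term ⊥ k
    threshold = con (integer (ℤ.+ p))

    threshold-value : fromℚ (integer (ℤ.+ p)) ≈ p · 1#
    threshold-value = fromℚ-integer (ℤ.+ p)

    piecewise : Definable → Definable → Definable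
    piecewise F F′ = record
      { graph  = cmp lt (affine (suc zero)) threshold ⋏ graph F ⋎
                 cmp le threshold (affine (suc zero)) ⋏ graph F′
      ; total  = λ x → [ (λ (y , γ) → y , inj₁ γ) , (λ (y , γ) → y , inj₂ γ) ]′ (sides x)
      ; unique = λ
          { x y y′ (inj₁ (_ , γ)) (inj₁ (_ , γ′)) → unique F x y y′ γ γ′
          ; x y y′ (inj₂ (_ , γ)) (inj₂ (_ , γ′)) → unique F′ x y y′ γ γ′
          ; x y y′ (inj₁ (l , _)) (inj₂ (r , _)) → ⊥-elim (<⇒≱ l r)
          ; x y y′ (inj₂ (r , _)) (inj₁ (l , _)) → ⊥-elim (<⇒≱ l r) }
      }
      where
      split : Carrier → Carrier
      split x = fromℚ (integer (ℤ.+ n)) * x + fromℚ (integer (ℤ.+ q))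
      c = fromℚ (integer (ℤ.+ p))
      sides : ∀ x → (Σ[ y ∈ Carrier ] (split x < c × Graph F y x)) ⊎
          (Σ[ y ∈ Carrier ] (c ≤ split x × Graph F′ y x))
      sides x with em {split x < c}
      ... | yes l = inj₁ (proj₁ (total F x) , l , proj₂ (total F x))
      ... | no ¬l = inj₂ (proj₁ (total F′ x) , ≮⇒≥ ¬l , proj₂ (total F′ x))

    module _ (0<n : 0# < n · 1#) where

      constant : Definable
      constant = record
        { graph  = cmp eq (affine zero) threshold
        ; total  = λ x → let d = p · 1# - q · 1# in d * (n · 1#) ⁻¹ ,
            trans (affine-value zero (d * (n · 1#) ⁻¹ Vector.∷ x Vector.∷ Vector.[]))
              (trans (+-congʳ (trans (*-comm _ _) (cancelʳ d 0<n)))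
                (trans (solve 2 (λ p q → p :- q :+ q := p) refl (p · 1#) (q · 1#))
                    (sym threshold-value)))
        ; unique = λ x y y′ γ γ′ → let e = trans (reduce x y γ) (sym (reduce x y′ γ′)) in
            ≤.antisym (cancel (≤.reflexive e)) (cancel (≤.reflexive (sym e)))
        }
        where
        reduce : ∀ x y → SatFOL (cmp eq (affine zero) threshold) (y Vector.∷ x Vector.∷ Vector.[]) →
                 n · 1# * y + q · 1# ≈ p · 1#
        reduce x y γ = trans (sym (affine-value zero (y Vector.∷ x Vector.∷ Vector.[])))
            (trans γ threshold-value)
        cancel : ∀ {y y′} → n · 1# * y + q · 1# ≤ n · 1# * y′ + q · 1# → y ≤ y′
        cancel {y} {y′} h = decidable-stable em λ y≰y′ → <⇒≱ (0<* 0<n (linear-< (≰⇒> y≰y′)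
              (solve 2 (λ y y′ → con (ℤ.+ 0) :+ y := y :- y′ :+ y′) refl y y′)))
            (linear h (solve 4 (λ n q y y′ →
                n :* (y :- y′) :+ (n :* y′ :+ q) := con (ℤ.+ 0) :+ (n :* y :+ q)) refl (n · 1#)
                (q · 1#) y y′))

  affine-≤ : ∀ n q {x y} → x ≤ y → n · 1# * x + q · 1# ≤ n · 1# * y + q · 1#
  affine-≤ n q x≤y = +-monoˡ-≤ (q · 1#) (*-monoˡ-≤ (0≤n n) x≤y)

  affine-reflects-< : ∀ n q {x y} → n · 1# * x + q · 1# < n · 1# * y + q · 1# → x ≤ y
  affine-reflects-< n q {x} {y} h = decidable-stable em λ x≰y →
      <⇒≱ h (affine-≤ n q (proj₁ (≰⇒> x≰y)))

  module _ {f : Carrier → Carrier} (continuous : Continuous f) {ε : Carrier} (0<ε : 0# < ε) where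

    abstract
      approximation-near : ∀ s → Σ[ F ∈ Definable ] Σ[ η ∈ Carrier ] 0# < η ×
        (∀ x y → Close η x s → Graph F y x → Close ε y (f x))
      approximation-near s =
        let ε′ , 0<ε′ , 2ε′≤ε = half 0<ε
            η , 0<η , near = continuous s ε′ 0<ε′
            n , p , q , 0<n , u<p , p<v =
                density {f s - ε′} {f s + ε′} (linear-< (0<+ 0<ε′ (proj₁ 0<ε′))
              (solve 2 (λ a e → a :- e :+ (e :+ e) := a :+ e :+ con (ℤ.+ 0)) refl (f s) ε′))
        in constant n p q 0<n , η , 0<η , λ x y x~s γ →
          let e = trans (sym (threshold-value n p q))
                  (trans (sym γ) (affine-value n p q zero (y Vector.∷ x Vector.∷ Vector.[])))
              u≤y = affine-reflects-< n q (<-≤-trans u<p (≤.reflexive e))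
              y≤v = affine-reflects-< n q (≤-<-trans (≤.reflexive (sym e)) p<v)
          in close-mono 2ε′≤ε (close-trans
               (y≤v , linear u≤y (solve 3 (λ a e y → a :+ y := y :+ e :+ (a :- e)) refl (f s) ε′ y))
               (close-sym (near x x~s)))

      -- Real induction on the right end. The approximation `F′` that is good up to `t` and the
      -- constant that is good near `s` are glued at a rational cut strictly between `s - η` and
      -- `t`: below the cut `x ≤ t`, above it `x` is within `η` of `s`.
      approximation : ∀ a b → Σ[ F ∈ Definable ] (∀ x y → a ≤ x → x ≤ b → Graph F y x →
          Close ε y (f x))
      approximation a b = real-induction
        (λ t → Σ[ F ∈ Definable ] (∀ x y → a ≤ x → x ≤ t → Graph F y x → Close ε y (f x)))
        (λ s≤t (F , good) → F , λ x y a≤x x≤s → good x y a≤x (≤.trans x≤s s≤t))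
        (let F , η , 0<η , good = approximation-near a in
          F , λ x y a≤x x≤a → good x y (close-≈ (proj₁ 0<η) (≤.antisym x≤a a≤x)))
        (λ s _ _ → let F , η , 0<η , good = approximation-near s in η , 0<η ,
            λ t s<t+η (F′ , good′) →
          let n , p , q , _ , u<p , p<v = density {s - η} {t}
                (linear-< s<t+η (solve 3 (λ s t e → s :- e :+ (t :+ e) := t :+ s) refl s t η))
              value x y = affine-value n p q (suc zero) (y Vector.∷ x Vector.∷ Vector.[])
          in piecewise n p q F′ F , λ
            { x y a≤x x≤s+η (inj₁ (l , γ)) → good′ x y a≤x
                (affine-reflects-< n q (≤-<-trans (≤.reflexive (sym (value x y)))
                  (≤-<-trans (proj₁ l) (≤-<-trans (≤.reflexive (threshold-value n p q)) p<v)))) γ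
            ; x y a≤x x≤s+η (inj₂ (r , γ)) → good x y (x≤s+η ,
                linear (affine-reflects-< n q
                    (<-≤-trans u<p (≤.trans (≤.reflexive (sym (threshold-value n p q)))
                    (≤.trans r (≤.reflexive (value x y))))))
                  (solve 3 (λ s e x → s :+ x := x :+ e :+ (s :- e)) refl s η x)) γ })

  -- Enclosures

  symmetric : ℕ → IQ
  symmetric m = [_,_] (integer (ℤ.- (ℤ.+ m))) (integer (ℤ.+ m))
    {ℚ.*≤* (ℤₚ.*-monoʳ-≤-nonNeg (ℤ.+ 1) {ℤ.- (ℤ.+ m)} {ℤ.+ m} ℤₚ.neg-≤-pos)}

  bounded⇒∈ : ∀ m {x} → Bounded-by (m · 1#) x → x ∈ᴵ symmetric m
  bounded⇒∈ m {x} (x≤m , -x≤m) =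
    ≤.trans (≤.reflexive (trans (fromℚ-integer (ℤ.- (ℤ.+ m))) (fromℤ-neg (ℤ.+ m)))) (neg-≤ -x≤m) ,
    ≤.trans x≤m (≤.reflexive (sym (fromℚ-integer (ℤ.+ m))))

  abstract
    magnitude-bound : ∀ I → Σ[ m ∈ ℕ ] (∀ x → x ∈ᴵ I → Bounded-by (m · 1#) x)
    magnitude-bound I =
      let u = fromℚ (IQ.upper I)
          l = fromℚ (IQ.lower I)
          M , u≤M , -l≤M = upper u (- l)
          m , M≤m = archimedes M
      in m , λ x (l≤x , x≤u) → ≤.trans x≤u (≤.trans u≤M M≤m) ,
           ≤.trans (linear l≤x (solve 2 (λ l x → :- x :+ x := :- l :+ l) refl l x))
               (≤.trans -l≤M M≤m)

  magnitude : IQ → ℕ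
  magnitude I = proj₁ (magnitude-bound I)

  ∈⇒bounded : ∀ I {x} → x ∈ᴵ I → Bounded-by (magnitude I · 1#) x
  ∈⇒bounded I {x} = proj₂ (magnitude-bound I) x

  abstract
    image-bound : ∀ h I → Σ[ m ∈ ℕ ] (∀ x → x ∈ᴵ I → Bounded-by (m · 1#) (interpretation h x))
    image-bound h I =
      let M , f≤M = image-bounded (interpretation-continuous h) {fromℚ (IQ.lower I)}
              {fromℚ (IQ.upper I)}
          m , M≤m = archimedes M
      in m , λ x (l≤x , x≤u) → bounded-mono M≤m (f≤M x l≤x x≤u)

  -- Interval arithmetic, rounded outwards to intervals [ - m , m ].
  enclosure : ∀ {n} → Domain n → Term Symbol n → IQ
  enclosure B (var i)   = B i
  enclosure B (con c)   = [_,_] c c {ℚₚ.≤-refl}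
  enclosure B (s ⊕ t)   = symmetric (magnitude (enclosure B s) ℕ.+ magnitude (enclosure B t))
  enclosure B (s ⊗ t)   = symmetric (magnitude (enclosure B s) ℕ.* magnitude (enclosure B t))
  enclosure B (app h t) = symmetric (suc (proj₁ (image-bound h (enclosure B t))))

  sum-∈ : ∀ I J {x y} → x ∈ᴵ I → y ∈ᴵ J → x + y ∈ᴵ symmetric (magnitude I ℕ.+ magnitude J)
  sum-∈ I J x∈I y∈J = bounded⇒∈ (magnitude I ℕ.+ magnitude J) (bounded-mono
    (≤.reflexive (sym (×-homo-+ 1# (magnitude I) (magnitude J))))
        (bounded-+ (∈⇒bounded I x∈I) (∈⇒bounded J y∈J)))

  product-∈ : ∀ I J {x y} → x ∈ᴵ I → y ∈ᴵ J → x * y ∈ᴵ symmetric (magnitude I ℕ.* magnitude J)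
  product-∈ I J x∈I y∈J = bounded⇒∈ (magnitude I ℕ.* magnitude J) (bounded-mono
    (≤.reflexive (sym (×1-homo-* (magnitude I) (magnitude J))))
        (bounded-* (∈⇒bounded I x∈I) (∈⇒bounded J y∈J)))

  -- The `suc` in the enclosure of an application is the room for `u`.
  application-∈ : ∀ {n} {B : Domain n} {x u} h e → x ∈ᴵ enclosure B e → Bounded-by 1# u →
                  interpretation h x + u ∈ᴵ enclosure B (app h e)
  application-∈ {B = B} {x} h e x∈I ∣u∣≤1 = bounded⇒∈ (suc (proj₁ (image-bound h (enclosure B e))))
      (bounded-mono (≤.reflexive (+-comm _ _))
    (bounded-+ (proj₂ (image-bound h (enclosure B e)) x x∈I) ∣u∣≤1))

  value-∈ : ∀ {n} {B : Domain n} {ω} t → InBox B ω → value t ω ∈ᴵ enclosure B t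
  value-∈ (var i)   ω∈B = ω∈B i
  value-∈ (con c)   ω∈B = ≤-refl , ≤-refl
  value-∈ {B = B} (s ⊕ t) ω∈B = sum-∈ (enclosure B s) (enclosure B t) (value-∈ {B = B} s ω∈B)
      (value-∈ {B = B} t ω∈B)
  value-∈ {B = B} (s ⊗ t) ω∈B = product-∈ (enclosure B s) (enclosure B t) (value-∈ {B = B} s ω∈B)
      (value-∈ {B = B} t ω∈B)
  value-∈ {B = B} {ω} (app h t) ω∈B = bounded⇒∈ (suc (proj₁ (image-bound h (enclosure B t))))
      (bounded-mono (proj₁ (n<1+n (proj₁ (image-bound h (enclosure B t)))))
    (proj₂ (image-bound h (enclosure B t)) (value t ω) (value-∈ {B = B} t ω∈B)))

  -- Uniform continuity of terms on a box

  Near : ∀ {n} → Carrier → State n → State n → Set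
  Near ε ω ω′ = ∀ i → Close ε (ω i) (ω′ i)

  -- Each subterm stays in its enclosure: the magnitudes bound the factors of a product, and the end
  -- points give the compact interval on which a symbol is uniformly continuous.
  value-uniformly-continuous : ∀ {n} (B : Domain n) t {ε} → 0# < ε → Σ[ η ∈ Carrier ] 0# < η ×
    (∀ ω ω′ → InBox B ω → InBox B ω′ → Near η ω ω′ → Close ε (value t ω) (value t ω′))
  value-uniformly-continuous B (var i) {ε} 0<ε = ε , 0<ε , λ ω ω′ _ _ near → near i
  value-uniformly-continuous B (con c) {ε} 0<ε = ε , 0<ε , λ ω ω′ _ _ _ → close-refl (proj₁ 0<ε)
  value-uniformly-continuous B (s ⊕ t) 0<ε =
    let ε′ , 0<ε′ , 2ε′≤ε = half 0<ε
        η , 0<η , s-close = value-uniformly-continuous B s 0<ε′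
        θ , 0<θ , t-close = value-uniformly-continuous B t 0<ε′
        κ , 0<κ , κ≤η , κ≤θ = lower 0<η 0<θ
    in κ , 0<κ , λ ω ω′ ω∈B ω′∈B near → close-mono 2ε′≤ε (close-+
         (s-close ω ω′ ω∈B ω′∈B (λ i → close-mono κ≤η (near i)))
         (t-close ω ω′ ω∈B ω′∈B (λ i → close-mono κ≤θ (near i))))
  value-uniformly-continuous B (s ⊗ t) 0<ε =
    let M = magnitude (enclosure B s) · 1#
        N = magnitude (enclosure B t) · 1#
        ε′ , 0<ε′ , 2ε′≤ε = half 0<ε
        ε₁ , 0<ε₁ , ε₁N≤ε′ = scale N 0<ε′
        ε₂ , 0<ε₂ , ε₂M≤ε′ = scale M 0<ε′
        η , 0<η , s-close = value-uniformly-continuous B s 0<ε₁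
        θ , 0<θ , t-close = value-uniformly-continuous B t 0<ε₂
        κ , 0<κ , κ≤η , κ≤θ = lower 0<η 0<θ
    in κ , 0<κ , λ ω ω′ ω∈B ω′∈B near → close-mono
         (≤.trans (+-mono-≤ (≤.trans (≤.reflexive (*-comm M ε₂)) ε₂M≤ε′) ε₁N≤ε′) 2ε′≤ε)
         (close-* (∈⇒bounded (enclosure B s) (value-∈ {B = B} s ω∈B))
             (∈⇒bounded (enclosure B t) (value-∈ {B = B} t ω′∈B))
           (s-close ω ω′ ω∈B ω′∈B (λ i → close-mono κ≤η (near i)))
           (t-close ω ω′ ω∈B ω′∈B (λ i → close-mono κ≤θ (near i))))
  value-uniformly-continuous B (app h t) 0<ε =
    let η , 0<η , h-close = uniformly-continuous (interpretation-continuous h) 0<ε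
        θ , 0<θ , t-close = value-uniformly-continuous B t 0<η
    in θ , 0<θ , λ ω ω′ ω∈B ω′∈B near →
         let l , u = value-∈ {B = B} t ω∈B
             l′ , u′ = value-∈ {B = B} t ω′∈B
         in h-close _ _ l u l′ u′ (t-close ω ω′ ω∈B ω′∈B near)

  -- States are functions, so `ω′` is only required to agree pointwise with the substituted values;
  -- this avoids extensionality.
  eval-sub : ∀ {F m n} J (σ : Fin m → Term F n) t {ω ω′} → (∀ i → eval J (σ i) ω ≡ ω′ i) →
             eval J (sub σ t) ω ≡ eval J t ω′
  eval-sub J σ (var i)   σω≡ω′ = σω≡ω′ i
  eval-sub J σ (con c)   σω≡ω′ = ≡.refl
  eval-sub J σ (s ⊕ t)   σω≡ω′ = ≡.cong₂ _+_ (eval-sub J σ s σω≡ω′) (eval-sub J σ t σω≡ω′)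
  eval-sub J σ (s ⊗ t)   σω≡ω′ = ≡.cong₂ _*_ (eval-sub J σ s σω≡ω′) (eval-sub J σ t σω≡ω′)
  eval-sub J σ (app h t) σω≡ω′ = ≡.cong (J h) (eval-sub J σ t σω≡ω′)

  eval-embed : ∀ {F n} (J : F → Carrier → Carrier) t {ω : State n} →
      eval J (embed t) ω ≡ polynomial t ω
  eval-embed J (var i) = ≡.refl
  eval-embed J (con c) = ≡.refl
  eval-embed J (s ⊕ t) = ≡.cong₂ _+_ (eval-embed J s) (eval-embed J t)
  eval-embed J (s ⊗ t) = ≡.cong₂ _*_ (eval-embed J s) (eval-embed J t)

  eval-weakened : ∀ {F n} (J : F → Carrier → Carrier) t {ω : State n} {y} →
                  eval J (wk 1 (embed t)) (y Vector.∷ ω) ≡ polynomial t ω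
  eval-weakened J t = ≡.trans (eval-sub J _ (embed t) (λ _ → ≡.refl)) (eval-embed J t)

  polynomial-∈ : ∀ {n} {B : Domain n} {ω} t → InBox B ω → polynomial t ω ∈ᴵ enclosure B (embed t)
  polynomial-∈ {B = B} t ω∈B =
    ≡.subst (_∈ᴵ enclosure B (embed t)) (eval-embed interpretation t)
        (value-∈ {B = B} (embed t) ω∈B)

  polynomial-uniformly-continuous : ∀ {n} (B : Domain n) t {ε} → 0# < ε → Σ[ η ∈ Carrier ] 0# < η ×
    (∀ ω ω′ → InBox B ω → InBox B ω′ → Near η ω ω′ → Close ε (polynomial t ω) (polynomial t ω′))
  polynomial-uniformly-continuous B t 0<ε =
    let η , 0<η , close = value-uniformly-continuous B (embed t) 0<ε
    in η , 0<η , λ ω ω′ ω∈B ω′∈B near →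
         ≡.subst₂ (Close _) (eval-embed interpretation t) (eval-embed interpretation t)
             (close ω ω′ ω∈B ω′∈B near)

  enclosure-cong : ∀ {n} {B C : Domain n} → (∀ i → B i ≡ C i) → ∀ t → enclosure B t ≡ enclosure C t
  enclosure-cong B≡C (var i)   = B≡C i
  enclosure-cong B≡C (con c)   = ≡.refl
  enclosure-cong B≡C (s ⊕ t)   = ≡.cong₂ (λ I J → symmetric (magnitude I ℕ.+ magnitude J))
      (enclosure-cong B≡C s) (enclosure-cong B≡C t)
  enclosure-cong B≡C (s ⊗ t)   = ≡.cong₂ (λ I J → symmetric (magnitude I ℕ.* magnitude J))
      (enclosure-cong B≡C s) (enclosure-cong B≡C t)
  enclosure-cong B≡C (app h t) = ≡.cong (λ I → symmetric (suc (proj₁ (image-bound h I))))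
      (enclosure-cong B≡C t)

  -- This makes `enclosure B ∘ σ` the right box for the intermediate scopes of a perturbation: there
  -- a term has the enclosure of the term of the formula that it stands for.
  enclosure-sub : ∀ {m n} {B : Domain n} (σ : Fin m → Term Symbol n) t →
                  enclosure B (sub σ t) ≡ enclosure (enclosure B ∘ σ) t
  enclosure-sub σ (var i)   = ≡.refl
  enclosure-sub σ (con c)   = ≡.refl
  enclosure-sub σ (s ⊕ t)   = ≡.cong₂ (λ I J → symmetric (magnitude I ℕ.+ magnitude J))
      (enclosure-sub σ s) (enclosure-sub σ t)
  enclosure-sub σ (s ⊗ t)   = ≡.cong₂ (λ I J → symmetric (magnitude I ℕ.* magnitude J))
      (enclosure-sub σ s) (enclosure-sub σ t)
  enclosure-sub σ (app h t) = ≡.cong (λ I → symmetric (suc (proj₁ (image-bound h I))))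
      (enclosure-sub σ t)

  embed-ren : ∀ {F m n} (ρ : Fin m → Fin n) t → embed {F} (ren ρ t) ≡ ren ρ (embed t)
  embed-ren ρ (var i) = ≡.refl
  embed-ren ρ (con c) = ≡.refl
  embed-ren ρ (s ⊕ t) = ≡.cong₂ _⊕_ (embed-ren ρ s) (embed-ren ρ t)
  embed-ren ρ (s ⊗ t) = ≡.cong₂ _⊗_ (embed-ren ρ s) (embed-ren ρ t)

  -- The box of the quantified variables

  hull : IQ → IQ → IQ
  hull I J = symmetric (magnitude I ℕ.+ magnitude J)

  between-∈-hull : ∀ I J {x y z} → x ∈ᴵ I → z ∈ᴵ J → x ≤ y → y ≤ z → y ∈ᴵ hull I J
  between-∈-hull I J {x} {y} {z} x∈I z∈J x≤y y≤z =
    let m = magnitude I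
        n = magnitude J
        _ , -x≤m = ∈⇒bounded I x∈I
        z≤n , _ = ∈⇒bounded J z∈J
        m+n = ≤.reflexive (sym (×-homo-+ 1# m n))
    in bounded⇒∈ (m ℕ.+ n)
        ( ≤.trans (≤.trans y≤z (≤.trans z≤n (nonneg⇒≤ (0≤n m) (+-comm (m · 1#) (n · 1#))))) m+n
        , ≤.trans (≤.trans (linear x≤y (solve 2 (λ x y → :- y :+ y := :- x :+ x) refl x y))
            (≤.trans -x≤m (nonneg⇒≤ (0≤n n) refl))) m+n )

  left-⊆-hull : ∀ I J → I ⊆ᴵ hull I J
  left-⊆-hull I J x x∈I = bounded⇒∈ (magnitude I ℕ.+ magnitude J)
      (bounded-mono (≤.trans (nonneg⇒≤ (0≤n (magnitude J)) refl)
    (≤.reflexive (sym (×-homo-+ 1# (magnitude I) (magnitude J))))) (∈⇒bounded I x∈I))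

  right-⊆-hull : ∀ I J → J ⊆ᴵ hull I J
  right-⊆-hull I J x x∈J = bounded⇒∈ (magnitude I ℕ.+ magnitude J)
      (bounded-mono (≤.trans (nonneg⇒≤ (0≤n (magnitude I)) (+-comm _ _))
    (≤.reflexive (sym (×-homo-+ 1# (magnitude I) (magnitude J))))) (∈⇒bounded J x∈J))

  range : ∀ {n} → Domain n → (a b : Term ⊥ n) → IQ
  range B a b = hull (enclosure B (embed a)) (enclosure B (embed b))

  extend : ∀ {n N} → Prefix n N → Domain n → Domain N
  extend done               B = B
  extend (quantify _ a b p) B = extend p (range B a b Vector.∷ B)

  extend-inject : ∀ {n N} (p : Prefix n N) B i → extend p B (inject p i) ≡ B i
  extend-inject done               B i = ≡.refl
  extend-inject (quantify _ a b p) B i = extend-inject p (range B a b Vector.∷ B) (suc i)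

  -- `extend` computes a range where the bounds live, whereas `Encloses` speaks of the bounds
  -- renamed into the scope of the matrix.
  enclosure-inject : ∀ {n N} (p : Prefix n N) B t →
                     enclosure (extend p B) (embed (ren (inject p) t)) ≡ enclosure B (embed t)
  enclosure-inject p B t = ≡.trans (≡.cong (enclosure (extend p B)) (embed-ren (inject p) t))
    (≡.trans (enclosure-sub (var ∘ inject p) (embed t))
        (enclosure-cong (extend-inject p B) (embed t)))

  encloses : ∀ {n N} (p : Prefix n N) B → Encloses p (enclosure (extend p B))
  encloses done B = tt
  encloses p@(quantify _ a b p′) B =
    ≡.subst₂ _⊆ᴵ_ (≡.sym (enclosure-inject p B a)) (≡.sym last)
        (left-⊆-hull _ (enclosure B (embed b))) ,
    ≡.subst₂ _⊆ᴵ_ (≡.sym (enclosure-inject p B b)) (≡.sym last)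
        (right-⊆-hull (enclosure B (embed a)) _) ,
    encloses p′ (range B a b Vector.∷ B)
    where last = extend-inject p′ (range B a b Vector.∷ B) zero

  isEnclosure-extend : ∀ {n} (φ : Bounded n) D → IsEnclosure φ (enclosure (extend (prefix φ) D))
  isEnclosure-extend φ D = record
    { constant    = λ c _ → ≤-refl , ≤-refl
    ; bounds      = encloses (prefix φ) D
    ; sum         = λ s t _ x y → sum-∈ _ _
    ; product     = λ s t _ x y → product-∈ _ _
    ; application = λ h e _ x u x∈I -1≤u u≤1 →
        application-∈ h e x∈I (u≤1 ,
            linear -1≤u (solve 2 (λ u o → :- u :+ u := o :+ :- o) refl u 1#))
    }

  -- Bounded formulas

  -- The semantics of `close` for arbitrary predicates. The thresholds of `Margin` are real numbers,
  -- which formulas cannot name, and formulas with and without symbols are compared at this level.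
  Within : ∀ {n N} → Prefix n N → (State N → Set) → State n → Set
  Within done                    P ω = P ω
  Within (quantify forAll a b p) P ω =
    ∀ y → polynomial a ω ≤ y → y ≤ polynomial b ω → Within p P (y Vector.∷ ω)
  Within (quantify exists a b p) P ω =
    Σ[ y ∈ Carrier ] (polynomial a ω ≤ y × y ≤ polynomial b ω × Within p P (y Vector.∷ ω))

  holdsᶜ : ∀ {n} → Clause n → (Term Symbol n → Set) → Set
  holdsᶜ (atom t) f = f t
  holdsᶜ (C or D) f = holdsᶜ C f ⊎ holdsᶜ D f

  holds : ∀ {n} → CNF n → (Term Symbol n → Set) → Set
  holds (clause C) f = holdsᶜ C f
  holds (L and M)  f = holds L f × holds M f

  module _ {F : Set} (J : F → Carrier → Carrier) where

    guarded : ∀ {n} (a b : Term ⊥ n) {ω y} → polynomial a ω ≤ y → y ≤ polynomial b ω →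
      Sat J (cmp le (wk 1 (embed a)) (var zero) ⋏ cmp le (var zero) (wk 1 (embed b))) (y Vector.∷ ω)
    guarded a b a≤y y≤b = ≡.subst (_≤ _) (≡.sym (eval-weakened J a)) a≤y ,
        ≡.subst (_ ≤_) (≡.sym (eval-weakened J b)) y≤b

    unguarded : ∀ {n} (a b : Term ⊥ n) {ω y} →
      Sat J (cmp le (wk 1 (embed a)) (var zero) ⋏ cmp le (var zero) (wk 1 (embed b)))
          (y Vector.∷ ω) →
      polynomial a ω ≤ y × y ≤ polynomial b ω
    unguarded a b (a≤y , y≤b) = ≡.subst (_≤ _) (eval-weakened J a) a≤y ,
        ≡.subst (_ ≤_) (eval-weakened J b) y≤b

    close⇒within : ∀ {n N} (p : Prefix n N) {P ω} → Sat J (close p P) ω → Within p (Sat J P) ω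
    close⇒within done                    h = h
    close⇒within (quantify forAll a b p) h = λ y a≤y y≤b →
        close⇒within p (h y (guarded a b a≤y y≤b))
    close⇒within (quantify exists a b p) (y , g , h) =
      let a≤y , y≤b = unguarded a b g in y , a≤y , y≤b , close⇒within p h

    within⇒close : ∀ {n N} (p : Prefix n N) {P ω} → Within p (Sat J P) ω → Sat J (close p P) ω
    within⇒close done                    h = h
    within⇒close (quantify forAll a b p) h = λ y g →
      let a≤y , y≤b = unguarded a b g in within⇒close p (h y a≤y y≤b)
    within⇒close (quantify exists a b p) (y , a≤y , y≤b , h) = y , guarded a b a≤y y≤b ,
        within⇒close p h

    mapClause⇒holds : ∀ {n} C {g : Term Symbol n → Formula F first-order n} {ω} →
                      Sat J (mapClause g C) ω → holdsᶜ C (λ t → Sat J (g t) ω)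
    mapClause⇒holds (atom t) h = h
    mapClause⇒holds (C or D) (inj₁ h) = inj₁ (mapClause⇒holds C h)
    mapClause⇒holds (C or D) (inj₂ h) = inj₂ (mapClause⇒holds D h)

    holds⇒mapClause : ∀ {n} C {g : Term Symbol n → Formula F first-order n} {ω} →
                      holdsᶜ C (λ t → Sat J (g t) ω) → Sat J (mapClause g C) ω
    holds⇒mapClause (atom t) h = h
    holds⇒mapClause (C or D) (inj₁ h) = inj₁ (holds⇒mapClause C h)
    holds⇒mapClause (C or D) (inj₂ h) = inj₂ (holds⇒mapClause D h)

    mapCNF⇒holds : ∀ {n} M {g : Term Symbol n → Formula F first-order n} {ω} →
                   Sat J (mapCNF g M) ω → holds M (λ t → Sat J (g t) ω)
    mapCNF⇒holds (clause C) h       = mapClause⇒holds C h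
    mapCNF⇒holds (L and M)  (g , h) = mapCNF⇒holds L g , mapCNF⇒holds M h

    holds⇒mapCNF : ∀ {n} M {g : Term Symbol n → Formula F first-order n} {ω} →
                   holds M (λ t → Sat J (g t) ω) → Sat J (mapCNF g M) ω
    holds⇒mapCNF (clause C) h       = holds⇒mapClause C h
    holds⇒mapCNF (L and M)  (g , h) = holds⇒mapCNF L g , holds⇒mapCNF M h

  inBox-∷ : ∀ {n} {B : Domain n} {ω} (a b : Term ⊥ n) {y} → InBox B ω → polynomial a ω ≤ y →
      y ≤ polynomial b ω →
            InBox (range B a b Vector.∷ B) (y Vector.∷ ω)
  inBox-∷ {B = B} a b ω∈B a≤y y≤b zero =
    between-∈-hull (enclosure B (embed a)) (enclosure B (embed b)) (polynomial-∈ {B = B} a ω∈B)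
        (polynomial-∈ {B = B} b ω∈B) a≤y y≤b
  inBox-∷ a b ω∈B a≤y y≤b (suc i) = ω∈B i

  -- The implication is asked for in the box only, since the estimates for perturbed atoms hold only
  -- there. The guards of the prefix keep the state inside.
  within-mono : ∀ {n N} (p : Prefix n N) {B P R} → (∀ ω → InBox (extend p B) ω → P ω → R ω) →
                ∀ {ω} → InBox B ω → Within p P ω → Within p R ω
  within-mono done                    P⇒R ω∈B h = P⇒R _ ω∈B h
  within-mono (quantify forAll a b p) {B} P⇒R ω∈B h = λ y a≤y y≤b →
    within-mono p {range B a b Vector.∷ B} P⇒R (inBox-∷ {B = B} a b ω∈B a≤y y≤b) (h y a≤y y≤b)
  within-mono (quantify exists a b p) {B} P⇒R ω∈B (y , a≤y , y≤b , h) =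
    y , a≤y , y≤b , within-mono p {range B a b Vector.∷ B} P⇒R (inBox-∷ {B = B} a b ω∈B a≤y y≤b) h

  holdsᶜ-mono : ∀ {n} (C : Clause n) {f g} → All (λ t → f t → g t) (atomsᶜ C) → holdsᶜ C f →
      holdsᶜ C g
  holdsᶜ-mono (atom t) (f⇒g All.∷ _) h = f⇒g h
  holdsᶜ-mono (C or D) f⇒g (inj₁ h) = inj₁ (holdsᶜ-mono C (Allₚ.++⁻ˡ (atomsᶜ C) f⇒g) h)
  holdsᶜ-mono (C or D) f⇒g (inj₂ h) = inj₂ (holdsᶜ-mono D (Allₚ.++⁻ʳ (atomsᶜ C) f⇒g) h)

  holds-mono : ∀ {n} (M : CNF n) {f g} → All (λ t → f t → g t) (atoms M) → holds M f → holds M g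
  holds-mono (clause C) f⇒g h       = holdsᶜ-mono C f⇒g h
  holds-mono (L and M)  f⇒g (h , k) = holds-mono L (Allₚ.++⁻ˡ (atoms L) f⇒g) h ,
      holds-mono M (Allₚ.++⁻ʳ (atoms L) f⇒g) k

  -- Margins of truth and falsity

  uniformly : ∀ {A : Set} (Q : A → Carrier → Set) → (∀ x {η κ} → η ≤ κ → Q x κ → Q x η) →
    (∀ x → Σ[ η ∈ Carrier ] 0# < η × Q x η) → ∀ xs → Σ[ η ∈ Carrier ] 0# < η × All (λ x → Q x η) xs
  uniformly Q antitone each []       = 1# , 0<1 , All.[]
  uniformly Q antitone each (x ∷ xs) =
    let η , 0<η , q = each x
        θ , 0<θ , qs = uniformly Q antitone each xs
        κ , 0<κ , κ≤η , κ≤θ = lower 0<η 0<θ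
    in κ , 0<κ , antitone x κ≤η q All.∷ All.map (λ {x} → antitone x κ≤θ) qs

  -- The threshold may have either sign, so that one stability lemma serves strict formulas, with
  -- `θ = ε`, and weak ones, with `θ = - ε`.
  Margin : ∀ {n N} → Prefix n N → CNF N → Carrier → State n → Set
  Margin p M θ = Within p (λ ω → holds M (λ t → θ ≤ value t ω))

  margin-antitone : ∀ {n N} (p : Prefix n N) M {θ κ ω B} → InBox B ω → κ ≤ θ → Margin p M θ ω →
      Margin p M κ ω
  margin-antitone p M {B = B} ω∈B κ≤θ =
      within-mono p {B} (λ ω _ → holds-mono M (All.tabulate λ _ → ≤.trans κ≤θ)) ω∈B

  -- The nearest point of the other interval: `y` moves only if it lies beyond an end point, and
  -- then at most as far as that end point moved.
  clamp : ∀ {η a b a′ b′ y} → 0# ≤ η → a′ ≤ b′ → Close η a a′ → Close η b b′ → a ≤ y → y ≤ b →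
          Σ[ y′ ∈ Carrier ] (a′ ≤ y′ × y′ ≤ b′ × Close η y y′)
  clamp {η} {a} {b} {a′} {b′} {y} 0≤η a′≤b′ a~a′ b~b′ a≤y y≤b =
    [ (λ y≤a′ → a′ , ≤-refl , a′≤b′ , ≤.trans y≤a′ (nonneg⇒≤ 0≤η refl) ,
        ≤.trans (proj₂ a~a′) (+-monoˡ-≤ η a≤y))
    , (λ a′≤y → [ (λ y≤b′ → y , a′≤y , y≤b′ , close-refl 0≤η)
                , (λ b′≤y → b′ , a′≤b′ , ≤-refl , ≤.trans y≤b (proj₁ b~b′) ,
                    ≤.trans b′≤y (nonneg⇒≤ 0≤η refl)) ]′
                (≤.total y b′)) ]′ (≤.total y a′)

  near-∷ : ∀ {n} {η y y′} {ω ω′ : State n} → Close η y y′ → Near η ω ω′ →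
      Near η (y Vector.∷ ω) (y′ Vector.∷ ω′)
  near-∷ y~y′ near zero    = y~y′
  near-∷ y~y′ near (suc i) = near i

  -- The modulus depends on the loss `ε` alone and is fixed before the thresholds, so it serves at
  -- positive and negative ones alike.
  margin-uniform : ∀ {n N} (p : Prefix n N) M B {ε} → 0# < ε → Σ[ η ∈ Carrier ] 0# < η ×
    (∀ ω ω′ → InBox B ω → InBox B ω′ → Genuine p ω → Genuine p ω′ → Near η ω ω′ →
     ∀ {θ κ} → κ + ε ≤ θ → Margin p M θ ω → Margin p M κ ω′)
  margin-uniform done M B {ε} 0<ε =
    let η , 0<η , continuous = uniformly
          (λ t η → ∀ ω ω′ → InBox B ω → InBox B ω′ → Near η ω ω′ → Close ε (value t ω) (value t ω′))
          (λ t η≤κ c ω ω′ ω∈B ω′∈B near → c ω ω′ ω∈B ω′∈B (λ i → close-mono η≤κ (near i)))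
          (λ t → value-uniformly-continuous B t 0<ε) (atoms M)
    in η , 0<η , λ ω ω′ ω∈B ω′∈B _ _ near {θ} {κ} κ+ε≤θ → holds-mono M (All.map
         (λ {t} c θ≤t → linear (≤.trans κ+ε≤θ (≤.trans θ≤t (proj₁ (c ω ω′ ω∈B ω′∈B near))))
           (solve 3 (λ k v e → k :+ (v :+ e) := v :+ (k :+ e)) refl κ (value t ω′) ε)) continuous)
  margin-uniform (quantify q a b p) M B {ε} 0<ε =
    let η , 0<η , ih = margin-uniform p M (range B a b Vector.∷ B) 0<ε
        -- The tolerance for the end points is the modulus `η` of the body: `clamp` moves the
        -- quantified variable as far as the end points move.
        η₁ , 0<η₁ , a-close = polynomial-uniformly-continuous B a 0<η
        η₂ , 0<η₂ , b-close = polynomial-uniformly-continuous B b 0<η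
        κ , 0<κ , κ≤η₁ , κ≤η₂ = lower 0<η₁ 0<η₂
        κ′ , 0<κ′ , κ′≤κ , κ′≤η = lower 0<κ 0<η
    in κ′ , 0<κ′ , λ ω ω′ ω∈B ω′∈B gen gen′ near κ+ε≤θ →
      let a~ = a-close ω ω′ ω∈B ω′∈B (λ i → close-mono (≤.trans κ′≤κ κ≤η₁) (near i))
          b~ = b-close ω ω′ ω∈B ω′∈B (λ i → close-mono (≤.trans κ′≤κ κ≤η₂) (near i))
      in step q (proj₁ 0<η) ih ω ω′ ω∈B ω′∈B gen gen′ (λ i → close-mono κ′≤η (near i)) a~ b~ κ+ε≤θ
    where
    step : ∀ q {η} → 0# ≤ η →
      (∀ ω ω′ → InBox (range B a b Vector.∷ B) ω → InBox (range B a b Vector.∷ B) ω′ →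
          Genuine p ω → Genuine p ω′ →
        Near η ω ω′ → ∀ {θ κ} → κ + ε ≤ θ → Margin p M θ ω → Margin p M κ ω′) →
      ∀ ω ω′ → InBox B ω → InBox B ω′ → Genuine (quantify q a b p) ω →
          Genuine (quantify q a b p) ω′ → Near η ω ω′ →
      Close η (polynomial a ω) (polynomial a ω′) → Close η (polynomial b ω) (polynomial b ω′) →
      ∀ {θ κ} → κ + ε ≤ θ → Margin (quantify q a b p) M θ ω → Margin (quantify q a b p) M κ ω′
    -- A challenge in the range at `ω′` is moved back to the range at `ω`, where `h` applies; in the
    -- existential case the witness moves from `ω` to `ω′`.
    step forAll 0≤η ih ω ω′ ω∈B ω′∈B (a≤b , gen) (a≤b′ , gen′) near a~ b~ κ+ε≤θ h = λ y a≤y y≤b →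
      let y′ , a≤y′ , y′≤b , y~y′ = clamp 0≤η a≤b (close-sym a~) (close-sym b~) a≤y y≤b
      in ih (y′ Vector.∷ ω) (y Vector.∷ ω′) (inBox-∷ {B = B} a b ω∈B a≤y′ y′≤b)
          (inBox-∷ {B = B} a b ω′∈B a≤y y≤b)
            (gen y′ a≤y′ y′≤b) (gen′ y a≤y y≤b) (near-∷ (close-sym y~y′) near) κ+ε≤θ
                (h y′ a≤y′ y′≤b)
    step exists 0≤η ih ω ω′ ω∈B ω′∈B (a≤b , gen) (a≤b′ , gen′) near a~ b~ κ+ε≤θ
        (y , a≤y , y≤b , h) =
      let y′ , a≤y′ , y′≤b , y~y′ = clamp 0≤η a≤b′ a~ b~ a≤y y≤b
      in y′ , a≤y′ , y′≤b , ih (y Vector.∷ ω) (y′ Vector.∷ ω′) (inBox-∷ {B = B} a b ω∈B a≤y y≤b)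
          (inBox-∷ {B = B} a b ω′∈B a≤y′ y′≤b)
            (gen y a≤y y≤b) (gen′ y′ a≤y′ y′≤b) (near-∷ y~y′ near) κ+ε≤θ h

  -- Compactness of the ranges of the quantifiers makes the truth of a strict formula and
  -- the falsity of a weak one stable under a perturbation of the atoms.
  strict⇒margin : ∀ {n N} (p : Prefix n N) M B ω → InBox B ω → Genuine p ω →
    Within p (λ ω → holds M (λ t → 0# < value t ω)) ω → Σ[ ε ∈ Carrier ] 0# < ε × Margin p M ε ω
  strict⇒margin done M B ω ω∈B gen h = cnf M h
    where
    Positive-at : (Carrier → Set) → Set
    Positive-at P = Σ[ ε ∈ Carrier ] 0# < ε × P ε
    clauses : ∀ C → holdsᶜ C (λ t → 0# < value t ω) →
        Positive-at (λ ε → holdsᶜ C (λ t → ε ≤ value t ω))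
    clauses (atom t) 0<t = value t ω , 0<t , ≤-refl
    clauses (C or D) (inj₁ h) = let ε , 0<ε , g = clauses C h in ε , 0<ε , inj₁ g
    clauses (C or D) (inj₂ h) = let ε , 0<ε , g = clauses D h in ε , 0<ε , inj₂ g
    cnf : ∀ M → holds M (λ t → 0# < value t ω) → Positive-at (λ ε → holds M (λ t → ε ≤ value t ω))
    cnf (clause C) h = clauses C h
    cnf (L and M) (g , h) =
      let ε , 0<ε , g′ = cnf L g
          η , 0<η , h′ = cnf M h
          κ , 0<κ , κ≤ε , κ≤η = lower 0<ε 0<η
      in κ , 0<κ , margin-antitone done L {B = B} ω∈B κ≤ε g′ ,
          margin-antitone done M {B = B} ω∈B κ≤η h′
  strict⇒margin (quantify exists a b p) M B ω ω∈B (_ , gen) (y , a≤y , y≤b , h) =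
    let ε , 0<ε , g = strict⇒margin p M (range B a b Vector.∷ B) (y Vector.∷ ω)
            (inBox-∷ {B = B} a b ω∈B a≤y y≤b) (gen y a≤y y≤b) h
    in ε , 0<ε , y , a≤y , y≤b , g
  strict⇒margin (quantify forAll a b p) M B ω ω∈B (a≤b , gen) h =
    let B′ = range B a b Vector.∷ B
        inB y a≤y y≤b = inBox-∷ {B = B} a b {y} ω∈B a≤y y≤b
        (ε , 0<ε) , g = compactness {Positive}
          -- The bounds on `y` are part of the relation because the joining argument must work for
          -- all `y`, while `margin-antitone` needs a state in the box.
          (λ (ε , _) y → polynomial a ω ≤ y → y ≤ polynomial b ω → Margin p M ε (y Vector.∷ ω))
          (λ (ε , 0<ε) (η , 0<η) → let κ , 0<κ , κ≤ε , κ≤η = lower 0<ε 0<η in (κ , 0<κ) ,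
            (λ y g a≤y y≤b → margin-antitone p M {B = B′} (inB y a≤y y≤b) κ≤ε (g a≤y y≤b)) ,
            (λ y g a≤y y≤b → margin-antitone p M {B = B′} (inB y a≤y y≤b) κ≤η (g a≤y y≤b)))
          a≤b
          (λ s a≤s s≤b →
            let ε , 0<ε , g = strict⇒margin p M B′ (s Vector.∷ ω) (inB s a≤s s≤b) (gen s a≤s s≤b)
                    (h s a≤s s≤b)
                -- Half of the margin at `s` pays for the move to `y`, the other half is left there.
                ε′ , 0<ε′ , 2ε′≤ε = half 0<ε
                η , 0<η , stable = margin-uniform p M B′ 0<ε′
            in (ε′ , 0<ε′) , η , 0<η , λ y a≤y y≤b y~s _ _ → stable (s Vector.∷ ω) (y Vector.∷ ω)
                 (inB s a≤s s≤b) (inB y a≤y y≤b) (gen s a≤s s≤b) (gen y a≤y y≤b)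
                 (near-∷ (close-sym y~s) (λ i → close-refl (proj₁ 0<η))) 2ε′≤ε g)
    in ε , 0<ε , λ y a≤y y≤b → g y a≤y y≤b a≤y y≤b

  -- The roles of the quantifiers are exchanged: one counterexample carries the margin of a
  -- universal quantifier, and compactness is needed for the existential one, all of whose witnesses
  -- must be refuted by a common `ε`.
  ¬weak⇒¬margin : ∀ {n N} (p : Prefix n N) M B ω → InBox B ω → Genuine p ω →
    ¬ Margin p M 0# ω → Σ[ ε ∈ Carrier ] 0# < ε × ¬ Margin p M (- ε) ω
  ¬weak⇒¬margin done M B ω ω∈B gen = cnf M
    where
    Refuted-at : (Carrier → Set) → Set
    Refuted-at P = Σ[ ε ∈ Carrier ] 0# < ε × ¬ P (- ε)
    clauses : ∀ C → ¬ holdsᶜ C (λ t → 0# ≤ value t ω) →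
        Refuted-at (λ θ → holdsᶜ C (λ t → θ ≤ value t ω))
    clauses (atom t) t≱0 =
      -- With `ε = - t` the weak inequality `- ε ≤ t` would hold, hence the half.
      let ε , 0<ε , 2ε≤-t = half (linear-< {x = 0#} {y = - value t ω} (≰⇒> t≱0)
            (solve 1 (λ t → con (ℤ.+ 0) :+ con (ℤ.+ 0) := :- t :+ t) refl (value t ω)))
      in ε , 0<ε , λ -ε≤t → <⇒≱ 0<ε (linear (+-mono-≤ -ε≤t 2ε≤-t)
           (solve 2 (λ e t → e :+ (t :+ :- t) := con (ℤ.+ 0) :+ (:- e :+ (e :+ e))) refl ε
               (value t ω)))
    clauses (C or D) ¬h =
      let ε , 0<ε , ¬g = clauses C (λ h → ¬h (inj₁ h))
          η , 0<η , ¬k = clauses D (λ h → ¬h (inj₂ h))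
          κ , 0<κ , κ≤ε , κ≤η = lower 0<ε 0<η
      in κ , 0<κ , λ
           { (inj₁ g) → ¬g (holdsᶜ-mono C (All.tabulate λ _ → ≤.trans (neg-antitone κ≤ε)) g)
           ; (inj₂ k) → ¬k (holdsᶜ-mono D (All.tabulate λ _ → ≤.trans (neg-antitone κ≤η)) k) }
    cnf : ∀ M → ¬ holds M (λ t → 0# ≤ value t ω) → Refuted-at (λ θ → holds M (λ t → θ ≤ value t ω))
    cnf (clause C) ¬h = clauses C ¬h
    cnf (L and M) ¬h with em {holds L (λ t → 0# ≤ value t ω)}
    ... | yes g = let ε , 0<ε , ¬k = cnf M (λ h → ¬h (g , h)) in ε , 0<ε , λ (_ , k) → ¬k k
    ... | no ¬g = let ε , 0<ε , ¬k = cnf L ¬g in ε , 0<ε , λ (k , _) → ¬k k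
  ¬weak⇒¬margin (quantify forAll a b p) M B ω ω∈B (_ , gen) ¬h =
    let y , a≤y , y≤b , ¬k = decidable-stable em λ none → ¬h λ y a≤y y≤b →
          decidable-stable em λ ¬k → none (y , a≤y , y≤b , ¬k)
        ε , 0<ε , ¬g = ¬weak⇒¬margin p M (range B a b Vector.∷ B) (y Vector.∷ ω)
            (inBox-∷ {B = B} a b ω∈B a≤y y≤b) (gen y a≤y y≤b) ¬k
    in ε , 0<ε , λ g → ¬g (g y a≤y y≤b)
  ¬weak⇒¬margin (quantify exists a b p) M B ω ω∈B (a≤b , gen) ¬h =
    let B′ = range B a b Vector.∷ B
        inB y a≤y y≤b = inBox-∷ {B = B} a b {y} ω∈B a≤y y≤b
        (ε , 0<ε) , ¬g = compactness {Positive}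
          (λ (ε , _) y → polynomial a ω ≤ y → y ≤ polynomial b ω →
              ¬ Margin p M (- ε) (y Vector.∷ ω))
          (λ (ε , 0<ε) (η , 0<η) → let κ , 0<κ , κ≤ε , κ≤η = lower 0<ε 0<η in (κ , 0<κ) ,
            (λ y ¬g a≤y y≤b g → ¬g a≤y y≤b
                (margin-antitone p M {B = B′} (inB y a≤y y≤b) (neg-antitone κ≤ε) g)) ,
            (λ y ¬g a≤y y≤b g → ¬g a≤y y≤b
                (margin-antitone p M {B = B′} (inB y a≤y y≤b) (neg-antitone κ≤η) g)))
          a≤b
          (λ s a≤s s≤b →
            let ε , 0<ε , ¬g = ¬weak⇒¬margin p M B′ (s Vector.∷ ω) (inB s a≤s s≤b) (gen s a≤s s≤b)
                  (λ h → ¬h (s , a≤s , s≤b , h))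
                ε′ , 0<ε′ , 2ε′≤ε = half 0<ε
                η , 0<η , stable = margin-uniform p M B′ 0<ε′
            in (ε′ , 0<ε′) , η , 0<η , λ y a≤y y≤b y~s _ _ g →
                ¬g (stable (y Vector.∷ ω) (s Vector.∷ ω)
                 (inB y a≤y y≤b) (inB s a≤s s≤b) (gen y a≤y y≤b) (gen s a≤s s≤b)
                 (near-∷ y~s (λ i → close-refl (proj₁ 0<η)))
                 (linear 2ε′≤ε (solve 2 (λ e e′ → :- e :+ e′ :+ e := :- e′ :+ (e′ :+ e′)) refl ε
                     ε′)) g))
    in ε , 0<ε , λ (y , a≤y , y≤b , g) → ¬g y a≤y y≤b a≤y y≤b g

  -- Perturbations

  -- Both directions are proved together since `⇒` and `~` exchange them.
  sat-sub : ∀ {F m n} J (P : Formula F first-order m) (σ : Fin m → Term F n) {ω ω′} →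
    (∀ i → eval J (σ i) ω ≡ ω′ i) →
        (Sat J (subᶠ σ P) ω → Sat J P ω′) × (Sat J P ω′ → Sat J (subᶠ σ P) ω)
  sat-sub J (cmp c s t) σ σω≡ω′ = let e = eval-sub J σ s σω≡ω′ ; f = eval-sub J σ t σω≡ω′ in
    ≡.subst₂ (compare c) e f , ≡.subst₂ (compare c) (≡.sym e) (≡.sym f)
  sat-sub J (P ⋏ R) σ σω≡ω′ = let p , p′ = sat-sub J P σ σω≡ω′ ; r , r′ = sat-sub J R σ σω≡ω′ in
    (λ (x , y) → p x , r y) , (λ (x , y) → p′ x , r′ y)
  sat-sub J (P ⋎ R) σ σω≡ω′ = let p , p′ = sat-sub J P σ σω≡ω′ ; r , r′ = sat-sub J R σ σω≡ω′ in
    [ inj₁ ∘ p , inj₂ ∘ r ]′ , [ inj₁ ∘ p′ , inj₂ ∘ r′ ]′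
  sat-sub J (P ⇒ R) σ σω≡ω′ = let p , p′ = sat-sub J P σ σω≡ω′ ; r , r′ = sat-sub J R σ σω≡ω′ in
    (λ f → r ∘ f ∘ p′) , (λ f → r′ ∘ f ∘ p)
  sat-sub J (~ P) σ σω≡ω′ = let p , p′ = sat-sub J P σ σω≡ω′ in (λ f → f ∘ p′) , (λ f → f ∘ p)
  sat-sub J (ALL P) σ {ω} {ω′} σω≡ω′ =
    (λ f x → proj₁ (under x) (f x)) , (λ f x → proj₂ (under x) (f x))
    where
    under : ∀ x → _
    under x = sat-sub J P (lift 1 σ) {x Vector.∷ ω} {x Vector.∷ ω′}
      λ { zero → ≡.refl ; (suc i) → ≡.trans (eval-sub J _ (σ i) (λ _ → ≡.refl)) (σω≡ω′ i) }
  sat-sub J (EX P) σ {ω} {ω′} σω≡ω′ =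
    (λ (x , f) → x , proj₁ (under x) f) , (λ (x , f) → x , proj₂ (under x) f)
    where
    under : ∀ x → _
    under x = sat-sub J P (lift 1 σ) {x Vector.∷ ω} {x Vector.∷ ω′}
      λ { zero → ≡.refl ; (suc i) → ≡.trans (eval-sub J _ (σ i) (λ _ → ≡.refl)) (σω≡ω′ i) }

  graph-sub : ∀ {n} F (e : Term ⊥ n) {ω w y} →
    (SatFOL (subᶠ (var zero Vector.∷ wk 2 e Vector.∷ Vector.[]) (graph F))
        (y Vector.∷ w Vector.∷ ω) → Graph F y (polynomial e ω)) ×
    (Graph F y (polynomial e ω) →
        SatFOL (subᶠ (var zero Vector.∷ wk 2 e Vector.∷ Vector.[]) (graph F))
        (y Vector.∷ w Vector.∷ ω))
  graph-sub F e = sat-sub (λ ()) (graph F) _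
    λ { zero → ≡.refl ; (suc zero) → eval-sub (λ ()) _ e (λ _ → ≡.refl) }

  near⇒close : ∀ {n} F (e : Term ⊥ n) δ {ω w} → SatFOL (near F e δ) (w Vector.∷ ω) →
               Σ[ y ∈ Carrier ] (Graph F y (polynomial e ω) × Close (fromℚ δ) w y)
  near⇒close F e δ {w = w} (y , γ , y-δ≤w , w≤y+δ) = y , proj₁ (graph-sub F e) γ , w≤y+δ ,
    linear (≤.≤-respˡ-≈ (+-congˡ (fromℚ-neg δ)) y-δ≤w)
        (solve 3 (λ y w d → y :+ w := w :+ d :+ (y :+ :- d)) refl y w (fromℚ δ))

  close⇒near : ∀ {n} F (e : Term ⊥ n) δ {ω w y} → Graph F y (polynomial e ω) → Close (fromℚ δ) w y →
               SatFOL (near F e δ) (w Vector.∷ ω)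
  close⇒near F e δ {w = w} {y} γ (w≤y+δ , y≤w+δ) = y , proj₂ (graph-sub F e) γ ,
    ≤.≤-respˡ-≈ (+-congˡ (sym (fromℚ-neg δ)))
        (linear y≤w+δ (solve 3 (λ y w d → y :+ :- d :+ (w :+ d) := w :+ y) refl y w (fromℚ δ))) ,
    w≤y+δ

  -- The invariant of the perturbation: after a replacement the term still stands for the same term
  -- of the formula, so the reference value does not change.
  sub-abstractApp : ∀ {K N} (σ : Fin K → Term Symbol N) h e t →
    sub (app h (sub σ (embed e)) Vector.∷ σ) (abstractApp h e t) ≡ sub σ t
  sub-abstractApp σ h e (var i) = ≡.refl
  sub-abstractApp σ h e (con c) = ≡.refl
  sub-abstractApp σ h e (s ⊕ t) = ≡.cong₂ _⊕_ (sub-abstractApp σ h e s) (sub-abstractApp σ h e t)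
  sub-abstractApp σ h e (s ⊗ t) = ≡.cong₂ _⊗_ (sub-abstractApp σ h e s) (sub-abstractApp σ h e t)
  sub-abstractApp σ h e (app g t) with em {g ≡ h × t ≡ embed e}
  ... | yes (≡.refl , ≡.refl) = ≡.refl
  ... | no _ = ≡.cong (app g) (sub-abstractApp σ h e t)

  innermost-cases : ∀ {K} (t : Term Symbol K) →
    (Σ[ p ∈ _ ] innermost t ≡ inj₁ p) ⊎ (Σ[ h ∈ _ ] Σ[ e ∈ _ ] innermost t ≡ inj₂ (h , e))
  innermost-cases t with innermost t
  ... | inj₁ p       = inj₁ (p , ≡.refl)
  ... | inj₂ (h , e) = inj₂ (h , e , ≡.refl)

  inj₁≢inj₂ : ∀ {A C : Set} {x : A} {y : C} → ¬ (inj₁ x ≡ inj₂ y)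
  inj₁≢inj₂ ()

  -- perturbAtom abstracts over innermost t and over refl : innermost t ≡ innermost t, whose
  -- type must become innermost t ≡ x.  To unfold perturbAtom, the two occurrences of t are
  -- therefore kept apart as t u and t tt, which are convertible but not syntactically equal.
  refl-at : ∀ {K} (t : ⊤ → Term Symbol K) u → innermost (t u) ≡ innermost (t tt)
  refl-at t u = ≡.refl

  module _ {n} (φ : Bounded n) (𝓕 : Approximation φ) (δ : ℚ) where

    -- The values that the function-free term at the end of the perturbation of t can take.
    data Outcome {K} (σ : Fin K → Term Symbol (scope φ)) (t : Term Symbol K) (ω : State K) :
        Carrier → Set where
      stop : ∀ p → innermost t ≡ inj₁ p → Outcome σ t ω (polynomial p ω)
      step : ∀ h e w {z} → innermost t ≡ inj₂ (h , e) →
          SatFOL (near (𝓕 h (sub σ (embed e))) e δ) (w Vector.∷ ω) →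
             Outcome (app h (sub σ (embed e)) Vector.∷ σ) (abstractApp h e t) (w Vector.∷ ω) z →
                 Outcome σ t ω z

    outcome-step : ∀ {K} {σ : Fin K → Term Symbol (scope φ)} {t ω z h e} →
        innermost t ≡ inj₂ (h , e) → Outcome σ t ω z →
      Σ[ w ∈ Carrier ] (SatFOL (near (𝓕 h (sub σ (embed e))) e δ) (w Vector.∷ ω) ×
        Outcome (app h (sub σ (embed e)) Vector.∷ σ) (abstractApp h e t) (w Vector.∷ ω) z)
    outcome-step found (stop p found′) = ⊥-elim (inj₁≢inj₂ (≡.trans (≡.sym found′) found))
    outcome-step found (step h e w found′ near o) with inj₂-injective (≡.trans (≡.sym found) found′)
    ... | ≡.refl = w , near , o

    module _ (r : Strictness) where

      perturbAtom-stop : ∀ {K} q (σ : Fin K → Term Symbol (scope φ)) (t : ⊤ → Term Symbol K)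
          (u : ⊤) k t≤k {p} →
        innermost (t tt) ≡ inj₁ p → perturbAtom q r φ 𝓕 δ σ (t tt) k t≤k ≡ cmp (comparison r) p
            (con 0ℚ)
      perturbAtom-stop q σ t u k t≤k found with innermost (t tt) | refl-at t u
      perturbAtom-stop q σ t u k t≤k ≡.refl | inj₁ p | _ = ≡.refl

      -- The bound for the recursive call is whichever proof unfolding produces. It is hidden in a
      -- sum, and the lemmas on outcomes accept any such proof.
      perturbAtom-step : ∀ {K} q (σ : Fin K → Term Symbol (scope φ)) (t : ⊤ → Term Symbol K)
          (u : ⊤) k t≤k {h e} →
        innermost (t tt) ≡ inj₂ (h , e) →
        Σ[ t′≤k ∈ _ ] perturbAtom q r φ 𝓕 δ σ (t tt) (suc k) t≤k ≡
          bound q (near (𝓕 h (sub σ (embed e))) e δ)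
            (perturbAtom q r φ 𝓕 δ (app h (sub σ (embed e)) Vector.∷ σ) (abstractApp h e (t tt)) k
                t′≤k)
      perturbAtom-step q σ t u k t≤k found with innermost (t tt) | (refl-at t u)
      perturbAtom-step q σ t u k t≤k ≡.refl | inj₂ (h , e) | _ = _ , ≡.refl

      -- This lemma and the next three show that a universal perturbation says that every outcome
      -- compares with zero as required, and an existential one that some outcome does.
      forAll⇒outcomes : ∀ {K} {σ : Fin K → Term Symbol (scope φ)} {t ω z} k t≤k →
        SatFOL (perturbAtom forAll r φ 𝓕 δ σ t k t≤k) ω → Outcome σ t ω z →
            compare (comparison r) z (fromℚ 0ℚ)
      forAll⇒outcomes {σ = σ} {t} {ω} k t≤k sat (stop p found) =
        ≡.subst (λ P → SatFOL P ω) (perturbAtom-stop forAll σ (λ _ → t) tt k t≤k found) sat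
      forAll⇒outcomes {t = t} zero t≤0 sat (step h e w found near o) =
        ⊥-elim (ℕₚ.n≮0 (ℕₚ.<-≤-trans (abstractApp-< h e t found) t≤0))
      forAll⇒outcomes {σ = σ} {t} {ω} (suc k) t≤k sat (step h e w found near o) =
        let t′≤k , unfold = perturbAtom-step forAll σ (λ _ → t) tt k t≤k found
        in forAll⇒outcomes k t′≤k (≡.subst (λ P → SatFOL P ω) unfold sat w near) o

      outcome⇒exists : ∀ {K} {σ : Fin K → Term Symbol (scope φ)} {t ω z} k t≤k →
        Outcome σ t ω z → compare (comparison r) z (fromℚ 0ℚ) →
            SatFOL (perturbAtom exists r φ 𝓕 δ σ t k t≤k) ω
      outcome⇒exists {σ = σ} {t} {ω} k t≤k (stop p found) c =
        ≡.subst (λ P → SatFOL P ω) (≡.sym (perturbAtom-stop exists σ (λ _ → t) tt k t≤k found)) c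
      outcome⇒exists {t = t} zero t≤0 (step h e w found near o) c =
        ⊥-elim (ℕₚ.n≮0 (ℕₚ.<-≤-trans (abstractApp-< h e t found) t≤0))
      outcome⇒exists {σ = σ} {t} {ω} (suc k) t≤k (step h e w found near o) c =
        let t′≤k , unfold = perturbAtom-step exists σ (λ _ → t) tt k t≤k found
        in ≡.subst (λ P → SatFOL P ω) (≡.sym unfold) (w , near , outcome⇒exists k t′≤k o c)

      outcomes⇒forAll : ∀ {K} (σ : Fin K → Term Symbol (scope φ)) t {ω} k t≤k →
        (∀ z → Outcome σ t ω z → compare (comparison r) z (fromℚ 0ℚ)) →
            SatFOL (perturbAtom forAll r φ 𝓕 δ σ t k t≤k) ω
      outcomes⇒forAll σ t {ω} k t≤k all with innermost-cases t
      ... | inj₁ (p , found) = ≡.subst (λ P → SatFOL P ω)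
              (≡.sym (perturbAtom-stop forAll σ (λ _ → t) tt k t≤k found)) (all _ (stop p found))
      outcomes⇒forAll σ t zero t≤0 all | inj₂ (h , e , found) =
        ⊥-elim (ℕₚ.n≮0 (ℕₚ.<-≤-trans (abstractApp-< h e t found) t≤0))
      outcomes⇒forAll σ t {ω} (suc k) t≤k all | inj₂ (h , e , found) =
        let t′≤k , unfold = perturbAtom-step forAll σ (λ _ → t) tt k t≤k found
        in ≡.subst (λ P → SatFOL P ω) (≡.sym unfold) λ w near →
             outcomes⇒forAll _ (abstractApp h e t) k t′≤k λ z o → all z (step h e w found near o)

      exists⇒outcome : ∀ {K} (σ : Fin K → Term Symbol (scope φ)) t {ω} k t≤k →
        SatFOL (perturbAtom exists r φ 𝓕 δ σ t k t≤k) ω →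
            Σ[ z ∈ Carrier ] Outcome σ t ω z × compare (comparison r) z (fromℚ 0ℚ)
      exists⇒outcome σ t {ω} k t≤k sat with innermost-cases t
      ... | inj₁ (p , found) = _ , stop p found ,
              ≡.subst (λ P → SatFOL P ω) (perturbAtom-stop exists σ (λ _ → t) tt k t≤k found) sat
      exists⇒outcome σ t zero t≤0 sat | inj₂ (h , e , found) =
        ⊥-elim (ℕₚ.n≮0 (ℕₚ.<-≤-trans (abstractApp-< h e t found) t≤0))
      exists⇒outcome σ t {ω} (suc k) t≤k sat | inj₂ (h , e , found) =
        let t′≤k , unfold = perturbAtom-step exists σ (λ _ → t) tt k t≤k found
            w , near , sat′ = ≡.subst (λ P → SatFOL P ω) unfold sat
            z , o , c = exists⇒outcome _ (abstractApp h e t) k t′≤k sat′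
        in z , step h e w found near o , c

  -- All pairs of a symbol and a term are covered, so no proof of occurrence has to be carried
  -- along. The graph is used because `near` speaks of a point on it.
  Accurate : ∀ {n} (φ : Bounded n) → Domain (scope φ) → ℚ → Approximation φ → Set
  Accurate φ B δ 𝓕 = ∀ h e s y → s ∈ᴵ enclosure B e → Graph (𝓕 h e) y s →
      Close (fromℚ δ) y (interpretation h s)

  module _ {n} (φ : Bounded n) (B : Domain (scope φ)) where

    -- Each new variable receives the exact value of the application that it replaces. The current
    -- state thus consists of values at `ω₀`, so each approximation is evaluated at a point of the
    -- enclosure of its argument, where it is accurate.
    exact-outcome : ∀ {𝓕 δ} → Accurate φ B δ 𝓕 → ∀ {ω₀} → InBox B ω₀ →
      ∀ {K} (σ : Fin K → Term Symbol (scope φ)) t {ω} k → applications t ℕ.≤ k →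
          (∀ i → ω i ≡ value (σ i) ω₀) →
      Outcome φ 𝓕 δ σ t ω (value (sub σ t) ω₀)
    exact-outcome {𝓕} {δ} accurate {ω₀} ω₀∈B σ t {ω} k t≤k ω≡σ with innermost-cases t
    ... | inj₁ (p , found) = ≡.subst (Outcome φ 𝓕 δ σ t ω)
            (≡.trans (≡.sym (eval-embed interpretation p)) (≡.trans
              (≡.cong (λ t → value t ω) (≡.sym (innermost-embed t found)))
              (≡.sym (eval-sub interpretation σ t (λ i → ≡.sym (ω≡σ i))))))
            (stop p found)
    exact-outcome accurate ω₀∈B σ t zero t≤0 ω≡σ | inj₂ (h , e , found) =
      ⊥-elim (ℕₚ.n≮0 (ℕₚ.<-≤-trans (abstractApp-< h e t found) t≤0))
    exact-outcome {𝓕} {δ} accurate {ω₀} ω₀∈B σ t {ω} (suc k) t≤k ω≡σ | inj₂ (h , e , found) =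
      let e′ = sub σ (embed e)
          F  = 𝓕 h e′
          s≡ = ≡.trans (eval-sub interpretation σ (embed e) (λ i → ≡.sym (ω≡σ i)))
              (eval-embed interpretation e)
          y , γ = total F (value e′ ω₀)
          w≈y = close-sym (accurate h e′ (value e′ ω₀) y (value-∈ {B = B} e′ ω₀∈B) γ)
      in step h e (value (app h e′) ω₀) found (close⇒near F e δ (≡.subst (Graph F y) s≡ γ) w≈y)
           (≡.subst (Outcome φ 𝓕 δ _ (abstractApp h e t) _)
             (≡.cong (λ t → value t ω₀) (sub-abstractApp σ h e t))
             (exact-outcome accurate ω₀∈B (app h e′ Vector.∷ σ) (abstractApp h e t) k
               (s≤s⁻¹ (ℕₚ.<-≤-trans (abstractApp-< h e t found) t≤k))
               λ { zero → ≡.refl ; (suc i) → ω≡σ i }))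

    abstract
      -- The modulus is chosen before the approximation and `δ`, from the end of the recursion
      -- backwards: the modulus of the abstracted term is the error allowed to the new variable. Two
      -- invariants pass to the larger scope, membership in the box and nearness to the exact
      -- values.
      outcomes-close : ∀ {K} (σ : Fin K → Term Symbol (scope φ)) t k → applications t ℕ.≤ k →
          ∀ {ε} → 0# < ε →
        Σ[ η ∈ Carrier ] 0# < η × (∀ {𝓕 δ} → Accurate φ B δ 𝓕 → fromℚ δ + fromℚ δ ≤ 1# →
            fromℚ δ ≤ η →
          ∀ {ω₀ ω z} → InBox B ω₀ → InBox (enclosure B ∘ σ) ω → Near η ω (λ i → value (σ i) ω₀) →
          Outcome φ 𝓕 δ σ t ω z → Close ε z (value (sub σ t) ω₀))
      outcomes-close σ t k t≤k {ε} 0<ε with innermost-cases t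
      ... | inj₁ (p , found) =
        let η , 0<η , continuous = value-uniformly-continuous (enclosure B ∘ σ) t 0<ε
        in η , 0<η , λ
          { _ _ _ {ω₀} {ω} ω₀∈B ω∈I near (stop p′ found′) → ≡.subst₂ (Close ε)
              (≡.trans (≡.cong (λ t → value t ω) (innermost-embed t found′))
                  (eval-embed interpretation p′))
              (≡.sym (eval-sub interpretation σ t (λ _ → ≡.refl)))
              (continuous ω _ ω∈I (λ i → value-∈ {B = B} (σ i) ω₀∈B) near)
          ; _ _ _ _ _ _ (step _ _ _ found′ _ _) → ⊥-elim (inj₁≢inj₂ (≡.trans (≡.sym found) found′))
              }
      outcomes-close σ t zero t≤0 0<ε | inj₂ (h , e , found) =
        ⊥-elim (ℕₚ.n≮0 (ℕₚ.<-≤-trans (abstractApp-< h e t found) t≤0))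
      outcomes-close σ t (suc k) t≤k {ε} 0<ε | inj₂ (h , e , found) =
        let e′ = sub σ (embed e)
            I = enclosure B e′
            I≡ = enclosure-sub {B = B} σ (embed e)
            θ , 0<θ , ih = outcomes-close (app h e′ Vector.∷ σ) (abstractApp h e t) k
              (s≤s⁻¹ (ℕₚ.<-≤-trans (abstractApp-< h e t found) t≤k)) 0<ε
            -- The error budget `θ` of the new variable: `θ₁` for the change in the argument of `h`,
            -- and two times `θ₂` for the approximation error and the radius of the interval, each
            -- at most `δ`.
            θ₁ , 0<θ₁ , 2θ₁≤θ = half 0<θ
            θ₂ , 0<θ₂ , 2θ₂≤θ₁ = half 0<θ₁
            κ , 0<κ , h-close = uniformly-continuous (interpretation-continuous h)
              {fromℚ (IQ.lower I)} {fromℚ (IQ.upper I)} 0<θ₁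
            η , 0<η , e-close = polynomial-uniformly-continuous (enclosure B ∘ σ) e 0<κ
            ζ , 0<ζ , ζ≤θ , ζ≤η = lower 0<θ 0<η
            ξ , 0<ξ , ξ≤ζ , ξ≤θ₂ = lower 0<ζ 0<θ₂
        in ξ , 0<ξ , λ {𝓕} {δ} accurate 2δ≤1 δ≤ξ {ω₀} {ω} {z} ω₀∈B ω∈I near o →
              let w , w-near , o = outcome-step φ 𝓕 δ found o
                  y , γ , w~y = near⇒close (𝓕 h e′) e δ w-near
                  s = polynomial e ω
                  s₀ = value e′ ω₀
                  s∈I = ≡.subst (s ∈ᴵ_) (≡.sym I≡) (polynomial-∈ {B = enclosure B ∘ σ} e ω∈I)
                  s₀∈I = value-∈ {B = B} e′ ω₀∈B
                  w~hs = close-trans w~y (accurate h e′ s y s∈I γ)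
                  s₀≡ = ≡.trans (≡.sym (eval-embed interpretation e))
                      (≡.sym (eval-sub interpretation σ (embed e) (λ _ → ≡.refl)))
                  s~s₀ = ≡.subst (Close κ s) s₀≡ (e-close ω _ ω∈I (λ i → value-∈ {B = B} (σ i) ω₀∈B)
                           (λ i → close-mono (≤.trans ξ≤ζ ζ≤η) (near i)))
                  hs~hs₀ = h-close s s₀ (proj₁ s∈I) (proj₂ s∈I) (proj₁ s₀∈I) (proj₂ s₀∈I) s~s₀
                  δ≤θ₂ = ≤.trans δ≤ξ ξ≤θ₂
                  w~hs₀ = close-mono (≤.trans (+-monoˡ-≤ θ₁ (≤.trans (+-mono-≤ δ≤θ₂ δ≤θ₂) 2θ₂≤θ₁))
                      2θ₁≤θ) (close-trans w~hs hs~hs₀)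
                  δ≤θ = ≤.trans δ≤ξ (≤.trans ξ≤ζ ζ≤θ)
                  -- The deviation of `w` from `h` at `s` is at most `δ + δ ≤ 1`, within the slack
                  -- of the enclosure.
                  w∈I : w ∈ᴵ enclosure B (app h e′)
                  w∈I = let hs+u = solve 2 (λ a w → a :+ (w :- a) := w) refl (interpretation h s) w
                            l , u = application-∈ {B = B} h e′ s∈I
                                (bounded-mono 2δ≤1 (close⇒bounded w~hs))
                        in ≤.≤-respʳ-≈ hs+u l , ≤.≤-respˡ-≈ hs+u u
              in ≡.subst (λ t → Close ε z (value t ω₀)) (sub-abstractApp σ h e t)
                   (ih accurate 2δ≤1 δ≤θ ω₀∈B (λ { zero → w∈I ; (suc i) → ω∈I i })
                     (λ { zero → w~hs₀ ; (suc i) → close-mono (≤.trans ξ≤ζ ζ≤θ) (near i) }) o)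

  -- Admissible sequences

  abstract
    -- A sequence assigns an approximation to every rational, so nonpositive ones get the default
    -- `1#`. Halving is needed because a supremum of deviations at most `ε` must still be strictly
    -- below `δ`.
    tolerance : ∀ c → Σ[ ε ∈ Carrier ] 0# < ε × (0# < c → ε + ε ≤ c)
    tolerance c with em {0# < c}
    ... | yes 0<c = let ε , 0<ε , 2ε≤c = half 0<c in ε , 0<ε , λ _ → 2ε≤c
    ... | no 0≮c  = 1# , 0<1 , λ 0<c → ⊥-elim (0≮c 0<c)

  -- 1 / (i + 3)
  precision : ℕ → ℚ
  precision i = mkℚ (ℤ.+ 1) (2 ℕ.+ i) (1-coprimeTo _)

  0<1+n : ∀ n → 0# < suc n · 1#
  0<1+n n = ≤-<-trans (0≤n n) (n<1+n n)

  0<precision : ∀ i → 0# < fromℚ (precision i)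
  0<precision i = 0<* (0<1+n 0) (0<⁻¹ (0<1+n (2 ℕ.+ i)))

  precision-scaled : ∀ i → fromℚ (precision i) * (3 ℕ.+ i) · 1# ≈ 1#
  precision-scaled i = trans (cancelʳ (1 · 1#) (0<1+n (2 ℕ.+ i))) (+-identityʳ 1#)

  2precision≤1 : ∀ i → fromℚ (precision i) + fromℚ (precision i) ≤ 1#
  2precision≤1 i = ≤.≤-respʳ-≈ (precision-scaled i) (nonneg⇒≤
    (*-nonneg (proj₁ (0<precision i)) (0≤n (suc i)))
    (trans (solve 3 (λ d o n → d :* (o :+ (o :+ (n))) := (d :* o :+ d :* o) :+ d :* n)
        refl (fromℚ (precision i)) 1# (suc i · 1#))
      (+-congʳ (+-cong (*-identityʳ _) (*-identityʳ _)))))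

  precision-small : ∀ {η} → 0# < η → Σ[ i ∈ ℕ ] fromℚ (precision i) ≤ η
  precision-small {η} 0<η =
    let n , η⁻¹≤n = archimedes (η ⁻¹)
        d = fromℚ (precision n)
        n≤3+n = ≤.trans (proj₁ (n<1+n n))
            (≤.trans (proj₁ (n<1+n (suc n))) (proj₁ (n<1+n (suc (suc n)))))
        dη⁻¹≤1 = ≤.≤-respʳ-≈ (precision-scaled n)
            (*-monoˡ-≤ (proj₁ (0<precision n)) (≤.trans η⁻¹≤n n≤3+n))
    in n , ≤.≤-respˡ-≈ (cancelʳ d 0<η) (≤.≤-respʳ-≈ (*-identityˡ η) (*-monoʳ-≤ (proj₁ 0<η) dη⁻¹≤1))

  precision→0 : ∀ ε → 0ℚ ℚ.< ε → Σ[ m ∈ ℕ ] (∀ i → m ℕ.≤ i → precision i ℚ.< ε)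
  precision→0 (mkℚ (ℤ.+ zero) d _) (ℚ.*<* 0<0) = ⊥-elim (ℤₚ.<-irrefl ≡.refl 0<0)
  precision→0 (mkℚ ℤ.-[1+ p ] d _) (ℚ.*<* ())
  -- Here `d` is the denominator less one; `d ≤ i` gives `d + 1 < i + 3`, and the numerator is at
  -- least 1.
  precision→0 (mkℚ (ℤ.+ (suc p)) d _) _ = d , λ i d≤i → ℚ.*<* (ℤ.+<+ (ℕₚ.<-≤-trans
    (s≤s (s≤s (ℕₚ.≤-trans (ℕₚ.≤-reflexive (ℕₚ.+-identityʳ d)) (ℕₚ.≤-trans d≤i (ℕₚ.n≤1+n i)))))
    (ℕₚ.m≤m+n (3 ℕ.+ i) (p ℕ.* (3 ℕ.+ i)))))

  precision-positive : ∀ i → 0ℚ ℚ.< precision i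
  precision-positive i = ℚ.*<* (ℤ.+<+ (s≤s ℕ.z≤n))

  -- The offset 3 is the least one that puts index 0 below `½`.
  precision<½ : ∀ i → precision i ℚ.< ½
  precision<½ i = ℚ.*<* (ℤ.+<+ (s≤s (s≤s (s≤s ℕ.z≤n))))

  module _ {n} (φ : Bounded n) (D : Domain n) where

    box-of-scope : Domain (scope φ)
    box-of-scope = extend (prefix φ) D

    abstract
      approximate : ∀ (δ : ℚ) h e →
          Σ[ F ∈ Definable ] (∀ x y → x ∈ᴵ enclosure box-of-scope e → Graph F y x →
        Close (proj₁ (tolerance (fromℚ δ))) y (interpretation h x))
      approximate δ h e =
        let ε , 0<ε , _ = tolerance (fromℚ δ)
            I = enclosure box-of-scope e
            F , good = approximation (interpretation-continuous h) 0<ε (fromℚ (IQ.lower I))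
                (fromℚ (IQ.upper I))
        in F , λ x y (l , u) → good x y l u

    admissible-approximation : ℚ → Approximation φ
    admissible-approximation δ h e = proj₁ (approximate δ h e)

    accurate : ∀ {δ} → 0# < fromℚ δ → Accurate φ box-of-scope δ (admissible-approximation δ)
    accurate {δ} 0<δ h e s y s∈I γ =
      let ε , 0<ε , 2ε≤δ = tolerance (fromℚ δ)
      in close-mono (≤.trans (nonneg⇒≤ (proj₁ 0<ε) refl) (2ε≤δ 0<δ))
          (proj₂ (approximate δ h e) s y s∈I γ)

    admissible : ∀ {δ} → 0# < fromℚ δ →
        Admissible φ (enclosure box-of-scope) δ (admissible-approximation δ)
    admissible {δ} 0<δ =
      let ε , 0<ε , 2ε≤δ = tolerance (fromℚ δ)
          ε<δ = <-≤-trans (linear-< 0<ε (solve 1 (λ e → e :+ e := e :+ e :+ con (ℤ.+ 0)) refl ε))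
              (2ε≤δ 0<δ)
          deviation≤ε : ∀ v → Deviation φ (enclosure box-of-scope) (admissible-approximation δ) v →
              v ≤ ε
          deviation≤ε = λ
            { v (inj₁ v≈0) → ≤.≤-respˡ-≈ (sym v≈0) (proj₁ 0<ε)
            ; v (inj₂ (h , e , s , _ , s∈I , v≈)) → ≤.≤-respˡ-≈ (sym v≈) (bounded-abs (close⇒bounded
                (proj₂ (approximate δ h e) s _ s∈I
                    (proj₂ (total (admissible-approximation δ h e) s))))) }
          v , lub = complete (Deviation φ (enclosure box-of-scope) (admissible-approximation δ))
              (0# , inj₁ refl) (ε , deviation≤ε)
      in v , lub , ≤-<-trans (proj₂ lub ε deviation≤ε) ε<δ

    admissibleSequence : AdmissibleSequence φ D
    admissibleSequence = record
      { I           = enclosure box-of-scope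
      ; isEnclosure = isEnclosure-extend φ D
      ; extends     = extend-inject (prefix φ) D
      ; δ           = precision
      ; δ-positive  = precision-positive
      ; δ-small     = precision<½
      ; δ→0         = precision→0
      ; 𝓕           = admissible-approximation
      ; admissible  = λ i → admissible {precision i} (0<precision i)
      }

    module _ (i : ℕ) where

      δᵢ = precision i
      𝓕ᵢ = admissible-approximation δᵢ

      exact : ∀ {ω} → InBox box-of-scope ω → ∀ t → Outcome φ 𝓕ᵢ δᵢ var t ω (value t ω)
      exact {ω} ω∈B t = ≡.subst (Outcome φ 𝓕ᵢ δᵢ var t ω)
          (eval-sub interpretation var t (λ _ → ≡.refl))
        (exact-outcome φ box-of-scope (accurate {precision i} (0<precision i)) ω∈B var t
            (applications t) ℕₚ.≤-refl (λ _ → ≡.refl))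

    OutcomesClose : Carrier → Term Symbol (scope φ) → Carrier → Set
    OutcomesClose ε t η = ∀ i → fromℚ (precision i) ≤ η → ∀ {ω z} → InBox box-of-scope ω →
      Outcome φ (admissible-approximation (precision i)) (precision i) var t ω z →
          Close ε z (value t ω)

    outcomes-close-at : ∀ {ε} → 0# < ε → ∀ t → Σ[ η ∈ Carrier ] 0# < η × OutcomesClose ε t η
    outcomes-close-at {ε} 0<ε t =
      let η , 0<η , c = outcomes-close φ box-of-scope var t (applications t) ℕₚ.≤-refl 0<ε
      in η , 0<η , λ i δ≤η {ω} {z} ω∈B o →
          ≡.subst (Close ε z) (eval-sub interpretation var t (λ _ → ≡.refl))
           (c {𝓕ᵢ i} {δᵢ i} (accurate {δᵢ i} (0<precision i)) (2precision≤1 i) δ≤η {ω} {ω} {z} ω∈B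
               ω∈B
             (λ _ → close-refl (proj₁ 0<η)) o)

    -- One index has to serve all atoms and all states of the box, because the whole perturbed
    -- formula is evaluated at a single `δ`.
    all-outcomes-close : ∀ {ε} → 0# < ε → Σ[ i ∈ ℕ ] All (λ t → ∀ {ω z} → InBox box-of-scope ω →
      Outcome φ (𝓕ᵢ i) (δᵢ i) var t ω z → Close ε z (value t ω)) (atoms (matrix φ))
    all-outcomes-close {ε} 0<ε =
      let η , 0<η , small = uniformly (OutcomesClose ε) (λ t η≤κ c i δ≤η → c i (≤.trans δ≤η η≤κ))
            (outcomes-close-at 0<ε) (atoms (matrix φ))
          i , δ≤η = precision-small 0<η
      in i , All.map (λ {t} c {ω} {z} → c i δ≤η {ω} {z}) small

  -- Robustness of strict and weak formulas

  module _ {n} (φ : Bounded n) (D : Domain n) where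

    private
      B = box-of-scope φ D

      Atomwise : (Term Symbol (scope φ) → State (scope φ) → Set) → State n → Set
      Atomwise P = Within (prefix φ) (λ ω → holds (matrix φ) (λ t → P t ω))

      atomwise-mono : ∀ (P R : Term Symbol (scope φ) → State (scope φ) → Set) →
        All (λ t → ∀ ω → InBox B ω → P t ω → R t ω) (atoms (matrix φ)) →
        ∀ {ω} → InBox D ω → Atomwise P ω → Atomwise R ω
      atomwise-mono P R P⇒R = within-mono (prefix φ) {D} λ ω ω∈B →
          holds-mono (matrix φ) (All.map (λ f → f ω ω∈B) P⇒R)

    module _ {F : Set} (J : F → Carrier → Carrier) (f : Term Symbol (scope φ) →
        Formula F first-order (scope φ)) where

      sat⇒atomwise : ∀ {ω} → InBox D ω → Sat J (close (prefix φ) (mapCNF f (matrix φ))) ω →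
          Atomwise (λ t → Sat J (f t)) ω
      sat⇒atomwise ω∈D h = within-mono (prefix φ) {D} (λ ω _ → mapCNF⇒holds J (matrix φ)) ω∈D
          (close⇒within J (prefix φ) h)

      atomwise⇒sat : ∀ {ω} → InBox D ω → Atomwise (λ t → Sat J (f t)) ω →
          Sat J (close (prefix φ) (mapCNF f (matrix φ))) ω
      atomwise⇒sat ω∈D h = within⇒close J (prefix φ)
          (within-mono (prefix φ) {D} (λ ω _ → holds⇒mapCNF J (matrix φ)) ω∈D h)

    atomᶠ : Strictness → Term Symbol (scope φ) → Formula Symbol first-order (scope φ)
    atomᶠ r t = cmp (comparison r) t (con 0ℚ)

    perturbed : Quantifier → Strictness → ℕ → Term Symbol (scope φ) → FOLℝ (scope φ)
    perturbed q r i t = perturbAtom q r φ (𝓕ᵢ φ D i) (δᵢ φ D i) var t (applications t) ℕₚ.≤-refl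

    True : Strictness → Term Symbol (scope φ) → State (scope φ) → Set
    True r t = Sat interpretation (atomᶠ r t)

    Perturbed : Quantifier → Strictness → ℕ → Term Symbol (scope φ) → State (scope φ) → Set
    Perturbed q r i t = SatFOL (perturbed q r i t)

    OutcomesWithin : Carrier → ℕ → Term Symbol (scope φ) → Set
    OutcomesWithin ε i t = ∀ {ω z} → InBox B ω → Outcome φ (𝓕ᵢ φ D i) (δᵢ φ D i) var t ω z →
        Close ε z (value t ω)

    -- An outcome loses at most `ε′`, half of the margin, and so remains at least `ε′`, which is
    -- strictly positive.
    margin⇒perturbed : ∀ {ε ε′ i t} → 0# < ε′ → ε′ + ε′ ≤ ε → OutcomesWithin ε′ i t →
      ∀ ω → InBox B ω → ε ≤ value t ω → Perturbed forAll strict i t ω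
    margin⇒perturbed {ε} {ε′} {i} {t} 0<ε′ 2ε′≤ε close ω ω∈B ε≤t =
      outcomes⇒forAll φ (𝓕ᵢ φ D i) (δᵢ φ D i) strict var t {ω} (applications t) ℕₚ.≤-refl λ z o →
        <-≤-trans (≤-<-trans (≤.reflexive (sym 0≈fromℚ0)) 0<ε′)
          (linear (≤.trans 2ε′≤ε (≤.trans ε≤t (proj₂ (close {ω} {z} ω∈B o))))
            (solve 2 (λ e z → e :+ (z :+ e) := z :+ (e :+ e)) refl ε′ z))

    perturbed⇒strict : ∀ i t ω → InBox B ω → Perturbed forAll strict i t ω → True strict t ω
    perturbed⇒strict i t ω ω∈B h =
      forAll⇒outcomes φ (𝓕ᵢ φ D i) (δᵢ φ D i) strict {t = t} {ω} {value t ω} (applications t)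
          ℕₚ.≤-refl h (exact φ D i {ω} ω∈B t)

    weak⇒perturbed : ∀ i t ω → InBox B ω → True weak t ω → Perturbed exists weak i t ω
    weak⇒perturbed i t ω ω∈B h =
      outcome⇒exists φ (𝓕ᵢ φ D i) (δᵢ φ D i) weak {t = t} {ω} {value t ω} (applications t)
          ℕₚ.≤-refl (exact φ D i {ω} ω∈B t) h

    perturbed⇒margin : ∀ {ε i t} → OutcomesWithin ε i t → ∀ ω → InBox B ω →
        Perturbed exists weak i t ω → - ε ≤ value t ω
    perturbed⇒margin {ε} {i} {t} close ω ω∈B h =
      let z , o , 0≤z = exists⇒outcome φ (𝓕ᵢ φ D i) (δᵢ φ D i) weak var t {ω} (applications t)
              ℕₚ.≤-refl h
      in linear (≤.trans (≤.trans (≤.reflexive 0≈fromℚ0) 0≤z) (proj₁ (close {ω} {z} ω∈B o)))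
           (solve 2 (λ e v → :- e :+ (v :+ e) := v :+ con (ℤ.+ 0)) refl ε (value t ω))

    strict-robust : (∀ ω → Genuine (prefix φ) ω) →
      ⟦ formula strict φ ⟧ D ≐ ⋃ ℕ (λ i → ⟦ 𝓐∀ strict φ (𝓕ᵢ φ D i) (δᵢ φ D i) ⟧FOL D)
    strict-robust genuine =
      (λ {ω} (ω∈D , sat) →
        let ε , 0<ε , margin = strict⇒margin (prefix φ) (matrix φ) D ω ω∈D (genuine ω)
              (atomwise-mono (True strict) (λ t ω → 0# < value t ω)
                (All.tabulate λ _ ω _ → ≤-<-trans (≤.reflexive 0≈fromℚ0)) ω∈D
                (sat⇒atomwise interpretation (atomᶠ strict) ω∈D sat))
            ε′ , 0<ε′ , 2ε′≤ε = half 0<ε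
            i , small = all-outcomes-close φ D 0<ε′
        in i , ω∈D , atomwise⇒sat (λ ()) (perturbed forAll strict i) ω∈D
             (atomwise-mono (λ t ω → ε ≤ value t ω) (Perturbed forAll strict i)
               (All.map (margin⇒perturbed {ε} 0<ε′ 2ε′≤ε) small) ω∈D margin)) ,
      (λ {ω} (i , ω∈D , sat) → ω∈D , atomwise⇒sat interpretation (atomᶠ strict) ω∈D
        (atomwise-mono (Perturbed forAll strict i) (True strict) (All.tabulate λ {t} _ →
            perturbed⇒strict i t)
          ω∈D (sat⇒atomwise (λ ()) (perturbed forAll strict i) ω∈D sat)))

    weak-robust : (∀ ω → Genuine (prefix φ) ω) →
      ⟦ formula weak φ ⟧ D ≐ ⋂ ℕ (λ i → ⟦ 𝓐∃ weak φ (𝓕ᵢ φ D i) (δᵢ φ D i) ⟧FOL D)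
    weak-robust genuine =
      (λ {ω} (ω∈D , sat) i → ω∈D , atomwise⇒sat (λ ()) (perturbed exists weak i) ω∈D
        (atomwise-mono (True weak) (Perturbed exists weak i) (All.tabulate λ {t} _ →
            weak⇒perturbed i t)
          ω∈D (sat⇒atomwise interpretation (atomᶠ weak) ω∈D sat))) ,
      -- Any index would do: each member of the intersection contains the condition that `ω` lies in
      -- `D`.
      (λ {ω} sat → let ω∈D = proj₁ (sat 0) in
        ω∈D , atomwise⇒sat interpretation (atomᶠ weak) ω∈D
            (atomwise-mono (λ t ω → 0# ≤ value t ω) (True weak)
          (All.tabulate λ _ ω _ → ≤.trans (≤.reflexive (sym 0≈fromℚ0))) ω∈D
          -- Were the formula false, the margin of its falsity would determine an index at which the
          -- perturbation is false too, whereas `sat` holds at all indices.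
          (decidable-stable em λ ¬φ →
            let ε , 0<ε , ¬margin = ¬weak⇒¬margin (prefix φ) (matrix φ) D ω ω∈D (genuine ω) ¬φ
                i , small = all-outcomes-close φ D 0<ε
            in ¬margin (atomwise-mono (Perturbed exists weak i) (λ t ω → - ε ≤ value t ω)
                 (All.map (λ {t} → perturbed⇒margin {ε} {i} {t}) small)
                 ω∈D (sat⇒atomwise (λ ()) (perturbed exists weak i) ω∈D (proj₂ (sat i)))))))

  open BoundedPure

  robust : ∀ {n} (r : Strictness) (φ : BoundedPure r n) →
    (r ≡ strict → ∀ D → ∀-Robust φ D) × (r ≡ weak → ∀ D → ∃-Robust φ D)
  robust r φ =
    (λ { ≡.refl D → admissibleSequence (bounded φ) D , strict-robust (bounded φ) D (genuine φ) }) ,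
    (λ { ≡.refl D → admissibleSequence (bounded φ) D , weak-robust (bounded φ) D (genuine φ) })

theorem5p9 : (em : ExcludedMiddle 0ℓ) (ℝ : CompleteOrderedField) →
    let open Classical em ℝ in
    ∀ {n} (r : Strictness) (φ : BoundedPure r n) →
    (r ≡ strict → ∀ (D : Domain n) → ∀-Robust φ D) ×
    (r ≡ weak → ∀ (D : Domain n) → ∃-Robust φ D)
theorem5p9 = robust
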